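{- Let $T_x$ be a rooted tree with root $x$, let $k\ge 1$, and let $L=\{L(v)\}_{v\in V(T_x)}$ be a list assignment with $|L(v)|=k$ for all $v\in V(T_x)$. Then $D(T_x;L)\ge D(T_x;k)$. Moreover, equality $D(T_x;L)=D(T_x;k)$ holds if and only if $D(T_x;L)=0$ or $L(u)=L(v)$ whenever $u$ and $v$ lie in the same orbit of $T_x$.
   Context: A rooted tree $T_x$ is a tree with a distinguished root $x$; its automorphisms are the tree automorphisms fixing $x$, and orbits are orbits of vertices under this automorphism group. A coloring is distinguishing if no nontrivial automorphism preserves all vertex colors. Two colorings $\phi_1,\phi_2$ of rooted trees $T_{v_1},T_{v_2}$ are equivalent if there is an isomorphism $\pi:V(T_{v_1})\to V(T_{v_2})$ with $\pi(v_1)=v_2$ and $\phi_1(u)=\phi_2(\pi(u))$ for all $u$. $D(T_x;k)$ denotes the number of equivalence classes of distinguishing $k$-colorings (colorings with colors in $\{1,\dots,k\}$) of $T_x$, and $D(T_x;L)$ denotes the number of equivalence classes of distinguishing $L$-colorings of $T_x$ (colorings $f$ with $f(v)\in L(v)$ for all $v$). -}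

module Defs where

open import Data.Nat using (ℕ; zero; suc; _≤_)
open import Data.Fin using (Fin)
open import Data.Product using (Σ; ∃; _×_; _,_)
open import Data.Sum using (_⊎_)
open import Data.List using (List; length)
open import Data.List.Membership.Propositional using (_∈_)
open import Data.List.Relation.Unary.Unique.Propositional using (Unique)
open import Relation.Binary.PropositionalEquality using (_≡_; _≢_)
open import Function.Definitions using (Bijective)
open import Function.Bundles using (_⇔_)

iter : ∀ {A : Set} → (A → A) → ℕ → A → A
iter f zero a = a
iter f (suc m) a = f (iter f m a)

-- A rooted tree on vertex set Fin n, given by its root and parent map:
-- the root is the unique fixed point, every vertex reaches the root by
-- iterating the parent map.  The edges are {v , parent v} for v ≠ root.
record RootedTree (n : ℕ) : Set where
  field
    root         : Fin n
    parent       : Fin n → Fin n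
    parent-root  : parent root ≡ root
    reaches-root : ∀ v → ∃ λ m → iter parent m v ≡ root

module _ {n : ℕ} (T : RootedTree n) where
  open RootedTree T

  Adj : Fin n → Fin n → Set
  Adj u v = (u ≢ v) × ((parent u ≡ v) ⊎ (parent v ≡ u))

  IsAut : (Fin n → Fin n) → Set
  IsAut σ = Bijective _≡_ _≡_ σ × (σ root ≡ root)
          × (∀ u v → Adj u v ⇔ Adj (σ u) (σ v))

  Coloring : Set
  Coloring = Fin n → ℕ

  IsDistinguishing : Coloring → Set
  IsDistinguishing c =
    ∀ σ → IsAut σ → (∀ v → c (σ v) ≡ c v) → ∀ v → σ v ≡ v

  Equivalent : Coloring → Coloring → Set
  Equivalent c₁ c₂ = ∃ λ σ → IsAut σ × (∀ u → c₁ u ≡ c₂ (σ u))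

  SameOrbit : Fin n → Fin n → Set
  SameOrbit u v = ∃ λ σ → IsAut σ × (σ u ≡ v)

  -- "the number of equivalence classes of distinguishing colorings
  --  satisfying Adm is m": a system of m pairwise inequivalent
  --  representatives covering all such colorings.
  ClassCount : (Coloring → Set) → ℕ → Set
  ClassCount Adm m = Σ (Fin m → Coloring) λ rep →
      (∀ i → Adm (rep i) × IsDistinguishing (rep i))
    × (∀ i j → Equivalent (rep i) (rep j) → i ≡ j)
    × (∀ c → Adm c → IsDistinguishing c → ∃ λ i → Equivalent c (rep i))

  IsKColoring : ℕ → Coloring → Set
  IsKColoring k c = ∀ v → (1 ≤ c v) × (c v ≤ k)

  IsLColoring : (Fin n → List ℕ) → Coloring → Set
  IsLColoring L c = ∀ v → c v ∈ L v

  DkIs : ℕ → ℕ → Set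
  DkIs k m = ClassCount (IsKColoring k) m

  DLIs : (Fin n → List ℕ) → ℕ → Set
  DLIs L m = ClassCount (IsLColoring L) m

-- list assignment with |L(v)| = k (lists without repetition, read as sets)
IsListAssignment : ∀ {n} → ℕ → (Fin n → List ℕ) → Set
IsListAssignment k L = ∀ v → Unique (L v) × (length (L v) ≡ k)

{-# OPTIONS --safe #-}
module Submission where

open import Defs
open import Data.Nat using (ℕ; zero; suc; _+_; _*_; _∸_; _≤_; _<_; z≤n; s≤s; >-nonZero)
open import Data.Nat.ListAction using (sum)
import Data.Nat.Properties as ℕ
open import Data.Fin as Fin using (Fin)
import Data.Fin.Properties as Fin
open import Data.Product using (Σ; ∃; _×_; _,_; proj₁; proj₂)
open import Data.Product.Properties using () renaming (≡-dec to ×-≡-dec)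
open import Data.Sum as Sum using (_⊎_; inj₁; inj₂)
open import Data.Maybe as Maybe using (Maybe; just; nothing)
import Data.Maybe.Properties as Maybe
open import Data.Empty using (⊥; ⊥-elim)
open import Data.Unit using (⊤; tt)
open import Data.List as List using (List; []; _∷_; _++_; length; map; filter; concatMap; cartesianProduct; upTo)
import Data.List.Properties as List
open import Data.List.Membership.Propositional using (_∈_; find; lose)
open import Data.List.Membership.Propositional.Properties
open import Data.List.Relation.Binary.Subset.Propositional using (_⊆_)
open import Data.List.Relation.Unary.All as All using (All; []; _∷_)
import Data.List.Relation.Unary.All.Properties as All
open import Data.List.Relation.Unary.AllPairs as AllPairs using (AllPairs; []; _∷_)
import Data.List.Relation.Unary.AllPairs.Properties as AllPairs
open import Data.List.Relation.Unary.Any as Any using (Any; here; there)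
import Data.List.Relation.Unary.Any.Properties as Any
open import Data.List.Relation.Unary.Unique.Propositional using (Unique)
import Data.List.Relation.Unary.Unique.Propositional.Properties as Unique
open import Function using (_∘_; id)
open import Function.Bundles using (_⇔_; mk⇔; Equivalence)
open import Relation.Nullary using (¬_; Dec; yes; no)
open import Relation.Nullary.Decidable using (map′; _×-dec_; _⊎-dec_; _→-dec_; ¬?; decidable-stable)
open import Relation.Binary.Definitions using (tri<; tri≈; tri>)
open import Relation.Unary using (Decidable)
open import Relation.Binary.PropositionalEquality using (_≡_; _≢_; _≗_; refl; sym; trans; cong; cong₂; subst; subst₂)

-- Count distinguishing colourings instead of classes.  Aut acts freely on all distinguishing
-- colourings, so D(T;k)·|Aut| is the number N(k) of distinguishing k-colourings, whereas a class may
-- contain fewer than |Aut| L-colourings, so N(L) ≤ D(T;L)·|Aut|.  Colouring the subtrees below a vertex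
-- one after another, each must avoid the classes of its earlier siblings; each such class excludes at
-- most one colouring per isomorphism of the two subtrees, and exactly that many for constant lists.
-- Hence N(L) ≥ N(k) by induction.  If D(T;L) = D(T;k), all these are equalities, so distinguishing
-- L-colourings are closed under Aut; if moreover D(T;k) > 0, the same greedy argument shows that every
-- c ∈ L(v) is attained at v, which makes L constant on orbits.  Conversely, if L is constant on orbits,
-- replacing each colour by its rank in its list embeds the classes of L-colourings in those of k-colourings.

-- Counting in filtered lists and products.

module _ {X : Set} where

  -- Pigeonhole: cut one occurrence of the head of `xs` out of `ys`. The tail of `xs` avoids that
  -- element, so it still fits into what remains.
  unique-⊆⇒length-≤ : ∀ {xs ys : List X} → Unique xs → xs ⊆ ys → length xs ≤ length ys
  unique-⊆⇒length-≤ {[]} _ _ = z≤n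
  unique-⊆⇒length-≤ {x ∷ xs} {ys} (x∉ ∷ u) sub with ∈-∃++ (sub (here refl))
  ... | as , bs , refl = subst (suc (length xs) ≤_) (sym (List.length-++-sucʳ as x bs)) (s≤s (unique-⊆⇒length-≤ u sub′))
    where
    sub′ : xs ⊆ as ++ bs
    sub′ {y} y∈ with ∈-++⁻ as (sub (there y∈))
    ... | inj₁ p = ∈-++⁺ˡ p
    ... | inj₂ (here refl) = ⊥-elim (All.lookup x∉ y∈ refl)
    ... | inj₂ (there p) = ∈-++⁺ʳ as p

  length-filter-split : ∀ {P : X → Set} (P? : Decidable P) xs →
    length (filter P? xs) + length (filter (¬? ∘ P?) xs) ≡ length xs
  length-filter-split P? [] = refl
  length-filter-split P? (x ∷ xs) with P? x
  ... | yes _ = cong suc (length-filter-split P? xs)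
  ... | no _ = trans (ℕ.+-suc _ _) (cong suc (length-filter-split P? xs))

  length-filter-filter : ∀ {P Q R : X → Set} (P? : Decidable P) (Q? : Decidable Q) (R? : Decidable R) →
    (∀ {x} → R x → P x × Q x) → (∀ {x} → P x → Q x → R x) →
    ∀ xs → length (filter Q? (filter P? xs)) ≡ length (filter R? xs)
  length-filter-filter P? Q? R? f g [] = refl
  length-filter-filter P? Q? R? f g (x ∷ xs) with P? x
  ... | no ¬p with R? x
  ...   | yes r = ⊥-elim (¬p (proj₁ (f r)))
  ...   | no _ = length-filter-filter P? Q? R? f g xs
  length-filter-filter P? Q? R? f g (x ∷ xs) | yes p with Q? x | R? x
  ... | yes q | yes r = cong suc (length-filter-filter P? Q? R? f g xs)
  ... | yes q | no ¬r = ⊥-elim (¬r (g p q))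
  ... | no ¬q | yes r = ⊥-elim (¬q (proj₂ (f r)))
  ... | no ¬q | no ¬r = length-filter-filter P? Q? R? f g xs

  length-filter-map : ∀ {Y : Set} {P : Y → Set} (P? : Decidable P) (f : X → Y) xs →
    length (filter P? (map f xs)) ≡ length (filter (P? ∘ f) xs)
  length-filter-map P? f [] = refl
  length-filter-map P? f (x ∷ xs) with P? (f x)
  ... | yes _ = cong suc (length-filter-map P? f xs)
  ... | no _ = length-filter-map P? f xs

module _ {X Y : Set} {P : X × Y → Set} {Q : X → Set} (P? : Decidable P) (Q? : Decidable Q) where

  private
    fibre : List Y → X → ℕ
    fibre ys x = length (filter (λ y → P? (x , y)) ys)

    filter-product : ∀ x xs ys →
      length (filter P? (cartesianProduct (x ∷ xs) ys)) ≡ fibre ys x + length (filter P? (cartesianProduct xs ys))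
    filter-product x xs ys = trans
      (cong length (List.filter-++ P? (map (x ,_) ys) (cartesianProduct xs ys)))
      (trans (List.length-++ (filter P? (map (x ,_) ys)))
             (cong (_+ _) (length-filter-map P? (x ,_) ys)))

  -- Pairs are counted fibre by fibre over the first component; fibres over points outside `Q` are
  -- simply discarded.
  filter-product-≥ : ∀ q xs ys →
    (∀ x → x ∈ xs → Q x → q ≤ length (filter (λ y → P? (x , y)) ys)) →
    length (filter Q? xs) * q ≤ length (filter P? (cartesianProduct xs ys))
  filter-product-≥ q [] ys h = z≤n
  filter-product-≥ q (x ∷ xs) ys h rewrite filter-product x xs ys with Q? x
  ... | yes p = ℕ.+-mono-≤ (h x (here refl) p) (filter-product-≥ q xs ys (λ x → h x ∘ there))
  ... | no _ = ℕ.≤-trans (filter-product-≥ q xs ys (λ x → h x ∘ there)) (ℕ.m≤n+m _ _)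

  -- Here the fibres outside `Q` cannot be discarded, but `P⇒Q` makes them empty.
  filter-product-≤ : ∀ q xs ys → (∀ {x y} → P (x , y) → Q x) →
    (∀ x → x ∈ xs → Q x → length (filter (λ y → P? (x , y)) ys) ≤ q) →
    length (filter P? (cartesianProduct xs ys)) ≤ length (filter Q? xs) * q
  filter-product-≤ q [] ys P⇒Q h = z≤n
  filter-product-≤ q (x ∷ xs) ys P⇒Q h rewrite filter-product x xs ys with Q? x
  ... | yes p = ℕ.+-mono-≤ (h x (here refl) p) (filter-product-≤ q xs ys P⇒Q (λ x → h x ∘ there))
  ... | no ¬p rewrite List.filter-none (λ y → P? (x , y)) {ys} (All.tabulate (λ _ → ¬p ∘ P⇒Q)) =
    filter-product-≤ q xs ys P⇒Q (λ x → h x ∘ there)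

-- Rooted trees built by grafting, with decidable parenthood.

infixl 5 _◁_

-- A ◁ B attaches B to the root of A as its last child; every finite rooted tree arises this way.
data Tree : Set where
  leaf : Tree
  _◁_  : Tree → Tree → Tree

data V : Tree → Set where
  tip : V leaf
  inl : ∀ {A B} → V A → V (A ◁ B)
  inr : ∀ {A B} → V B → V (A ◁ B)

root : ∀ t → V t
root leaf = tip
root (A ◁ B) = inl (root A)

-- Par u v: v is the parent of u.
data Par : ∀ {t} → V t → V t → Set where
  parˡ  : ∀ {A B} {u v : V A} → Par u v → Par (inl {A} {B} u) (inl v)
  parʳ  : ∀ {A B} {u v : V B} → Par u v → Par (inr {A} {B} u) (inr v)
  graft : ∀ {A B} {u : V B} {v : V A} → u ≡ root B → v ≡ root A → Par (inr {A} {B} u) (inl v)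

inl-injective : ∀ {A B} {u v : V A} → inl {A} {B} u ≡ inl v → u ≡ v
inl-injective refl = refl

inr-injective : ∀ {A B} {u v : V B} → inr {A} {B} u ≡ inr v → u ≡ v
inr-injective refl = refl

infix 4 _≟_

_≟_ : ∀ {t} (u v : V t) → Dec (u ≡ v)
tip ≟ tip = yes refl
inl u ≟ inl v = map′ (cong inl) inl-injective (u ≟ v)
inl u ≟ inr v = no λ ()
inr u ≟ inl v = no λ ()
inr u ≟ inr v = map′ (cong inr) inr-injective (u ≟ v)

par? : ∀ {t} (u v : V t) → Dec (Par u v)
par? tip tip = no λ ()
par? (inl u) (inl v) = map′ parˡ (λ { (parˡ p) → p }) (par? u v)
par? (inl u) (inr v) = no λ ()
par? (inr u) (inl v) = map′ (λ (p , q) → graft p q) (λ { (graft p q) → p , q }) ((u ≟ root _) ×-dec (v ≟ root _))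
par? (inr u) (inr v) = map′ parʳ (λ { (parʳ p) → p }) (par? u v)

all? : ∀ t {P : V t → Set} → (∀ v → Dec (P v)) → Dec (∀ v → P v)
all? leaf P? = map′ (λ { p tip → p }) (λ f → f tip) (P? tip)
all? (A ◁ B) P? = map′ (λ { (p , q) (inl v) → p v ; (p , q) (inr v) → q v }) (λ f → f ∘ inl , f ∘ inr)
  (all? A (P? ∘ inl) ×-dec all? B (P? ∘ inr))

any? : ∀ t {P : V t → Set} → (∀ v → Dec (P v)) → Dec (∃ P)
any? leaf P? = map′ (tip ,_) (λ { (tip , p) → p }) (P? tip)
any? (A ◁ B) P? = map′ (λ { (inj₁ (v , p)) → inl v , p ; (inj₂ (v , p)) → inr v , p })
  (λ { (inl v , p) → inj₁ (v , p) ; (inr v , p) → inj₂ (v , p) }) (any? A (P? ∘ inl) ⊎-dec any? B (P? ∘ inr))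

-- Induction from the root downwards: the root of a grafted `B` is a child of the root of `A`, so
-- the case for `B` can start there.
V-induction : ∀ t (P : V t → Set) → P (root t) → (∀ {u v} → Par u v → P v → P u) → ∀ v → P v
V-induction leaf P r s tip = r
V-induction (A ◁ B) P r s (inl v) = V-induction A (P ∘ inl) r (s ∘ parˡ) v
V-induction (A ◁ B) P r s (inr v) = V-induction B (P ∘ inr) (s (graft refl refl) r) (s ∘ parʳ) v

root-or-child : ∀ {t} (v : V t) → v ≡ root t ⊎ ∃ (Par v)
root-or-child {t} = V-induction t _ (inj₁ refl) (λ p _ → inj₂ (_ , p))

root-no-parent : ∀ t {v : V t} → ¬ Par (root t) v
root-no-parent (A ◁ B) (parˡ p) = root-no-parent A p

par-functional : ∀ {t} {u v w : V t} → Par u v → Par u w → v ≡ w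
par-functional (parˡ p) (parˡ q) = cong inl (par-functional p q)
par-functional (parʳ p) (parʳ q) = cong inr (par-functional p q)
par-functional (parʳ p) (graft refl _) = ⊥-elim (root-no-parent _ p)
par-functional (graft refl _) (parʳ p) = ⊥-elim (root-no-parent _ p)
par-functional (graft _ refl) (graft _ refl) = refl

par-asym : ∀ {t} {u v : V t} → Par u v → ¬ Par v u
par-asym (parˡ p) (parˡ q) = par-asym p q
par-asym (parʳ p) (parʳ q) = par-asym p q

-- Isomorphisms of rooted trees.

record IsIso {A B : Tree} (τ : V A → V B) : Set where
  field
    injective  : ∀ {u v} → τ u ≡ τ v → u ≡ v
    surjective : ∀ w → ∃ λ v → τ v ≡ w
    par⁺       : ∀ {u v} → Par u v → Par (τ u) (τ v)
    par⁻       : ∀ {u v} → Par (τ u) (τ v) → Par u v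

open IsIso

iso? : ∀ {A B} (τ : V A → V B) → Dec (IsIso τ)
iso? {A} {B} τ = map′
  (λ (i , s , p , q) → record { injective = i _ _ ; surjective = s ; par⁺ = p _ _ ; par⁻ = q _ _ })
  (λ h → (λ _ _ → injective h) , surjective h , (λ _ _ → par⁺ h) , (λ _ _ → par⁻ h))
  (all? A (λ u → all? A (λ v → (τ u ≟ τ v) →-dec (u ≟ v)))
   ×-dec all? B (λ w → any? A (λ v → τ v ≟ w))
   ×-dec all? A (λ u → all? A (λ v → par? u v →-dec par? (τ u) (τ v)))
   ×-dec all? A (λ u → all? A (λ v → par? (τ u) (τ v) →-dec par? u v)))

iso-id : ∀ {A} → IsIso {A} id
iso-id = record { injective = id ; surjective = λ w → w , refl ; par⁺ = id ; par⁻ = id }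

iso-∘ : ∀ {A B C} {τ : V B → V C} {π : V A → V B} → IsIso τ → IsIso π → IsIso (τ ∘ π)
iso-∘ {τ = τ} {π} i j = record
  { injective = injective j ∘ injective i
  ; surjective = λ w → let (v , p) = surjective i w ; (u , q) = surjective j v in u , trans (cong τ q) p
  ; par⁺ = par⁺ i ∘ par⁺ j
  ; par⁻ = par⁻ j ∘ par⁻ i }

iso-resp-≗ : ∀ {A B} {τ π : V A → V B} → τ ≗ π → IsIso τ → IsIso π
iso-resp-≗ {A} {B} {τ} {π} e i = record
  { injective = λ p → injective i (trans (e _) (trans p (sym (e _))))
  ; surjective = λ w → let (v , p) = surjective i w in v , trans (sym (e v)) p
  ; par⁺ = λ p → subst₂ Par (e _) (e _) (par⁺ i p)
  ; par⁻ = λ p → par⁻ i (subst₂ Par (sym (e _)) (sym (e _)) p) }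

module _ {A B} {τ : V A → V B} (i : IsIso τ) where

  inverse : V B → V A
  inverse w = proj₁ (surjective i w)

  inverseʳ : ∀ w → τ (inverse w) ≡ w
  inverseʳ w = proj₂ (surjective i w)

  inverseˡ : ∀ v → inverse (τ v) ≡ v
  inverseˡ v = injective i (inverseʳ (τ v))

  iso-inverse : IsIso inverse
  iso-inverse = record
    { injective = λ {u} {v} p → trans (sym (inverseʳ u)) (trans (cong τ p) (inverseʳ v))
    ; surjective = λ v → τ v , inverseˡ v
    ; par⁺ = λ {u} {v} p → par⁻ i (subst₂ Par (sym (inverseʳ u)) (sym (inverseʳ v)) p)
    ; par⁻ = λ {u} {v} p → subst₂ Par (inverseʳ u) (inverseʳ v) (par⁺ i p) }

  -- The root is the only vertex without a parent, and isomorphisms reflect parents.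
  iso-root : τ (root A) ≡ root B
  iso-root with root-or-child (τ (root A))
  ... | inj₁ p = p
  ... | inj₂ (w , p) = ⊥-elim (root-no-parent A (par⁻ i (subst (Par _) (sym (inverseʳ w)) p)))

-- Coloured trees and distinguishing colourings.

ColoredTree : Set
ColoredTree = Σ Tree λ t → V t → ℕ

record CIso (x y : ColoredTree) : Set where
  constructor ciso
  field
    to        : V (proj₁ x) → V (proj₁ y)
    isIso     : IsIso to
    preserves : proj₂ y ∘ to ≗ proj₂ x

ciso-≗ : ∀ {t} {c d : V t → ℕ} → d ≗ c → CIso (t , c) (t , d)
ciso-≗ e = ciso id iso-id e

ciso-sym : ∀ {x y} → CIso x y → CIso y x
ciso-sym {x , c} {y , d} (ciso τ i e) = ciso (inverse i) (iso-inverse i) λ w → trans (sym (e _)) (cong d (inverseʳ i w))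

ciso-trans : ∀ {x y z} → CIso x y → CIso y z → CIso x z
ciso-trans (ciso τ i e) (ciso π j f) = ciso (π ∘ τ) (iso-∘ j i) λ v → trans (f (τ v)) (e v)

Dist : ColoredTree → Set
Dist (t , c) = ∀ τ → IsIso {t} {t} τ → c ∘ τ ≗ c → τ ≗ id

-- Conjugation by `π` turns a colour-preserving automorphism of `x` into one of `y`, which is
-- trivial.
dist-resp-ciso : ∀ {x y} → CIso x y → Dist y → Dist x
dist-resp-ciso {x , c} {y , d} (ciso π j e) h τ i p v = injective j
  (trans (cong (π ∘ τ) (sym (inverseˡ j v)))
    (h (π ∘ τ ∘ inverse j) (iso-∘ j (iso-∘ i (iso-inverse j)))
      (λ w → trans (e _) (trans (p _) (trans (sym (e _)) (cong d (inverseʳ j w))))) (π v)))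

-- Coloured subtrees below the children of the root, and restriction to subtrees.

kids : (t : Tree) → (V t → ℕ) → List ColoredTree
kids leaf c = []
kids (A ◁ B) c = (B , c ∘ inr) ∷ kids A (c ∘ inl)

Fresh : ColoredTree → List ColoredTree → Set
Fresh x = All (λ y → ¬ CIso x y)

-- C sits in T as the full subtree below a non-root vertex.
record IsSubtree {C T : Tree} (e : V C → V T) : Set where
  field
    injective   : ∀ {u v} → e u ≡ e v → u ≡ v
    par⁺        : ∀ {u v} → Par u v → Par (e u) (e v)
    par⁻        : ∀ {u v} → Par (e u) (e v) → Par u v
    down-closed : ∀ {x v} → Par x (e v) → ∃ λ u → e u ≡ x
    avoids-root : ∀ v → e v ≢ root T

module S = IsSubtree

inr-subtree : ∀ {A B} → IsSubtree (inr {A} {B})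
inr-subtree = record
  { injective = inr-injective ; par⁺ = parʳ ; par⁻ = λ { (parʳ p) → p }
  ; down-closed = λ { (parʳ p) → _ , refl } ; avoids-root = λ _ () }

inl-subtree : ∀ {C A B} {e : V C → V A} → IsSubtree e → IsSubtree (inl {A} {B} ∘ e)
inl-subtree s = record
  { injective = S.injective s ∘ inl-injective ; par⁺ = parˡ ∘ S.par⁺ s ; par⁻ = λ { (parˡ p) → S.par⁻ s p }
  ; down-closed = λ { (parˡ p) → let (u , q) = S.down-closed s p in u , cong inl q
                    ; (graft _ q) → ⊥-elim (S.avoids-root s _ q) }
  ; avoids-root = λ v p → S.avoids-root s v (inl-injective p) }

-- Ties a child of the root, known only as a vertex, to its entry in `kids`, so that freshness can
-- be applied to it.
kid-at : ∀ t (c : V t → ℕ) {u} → Par u (root t) →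
  ∃ λ C → Σ (V C → V t) λ e → IsSubtree e × (e (root C) ≡ u) × ((C , c ∘ e) ∈ kids t c)
kid-at (A ◁ B) c (parˡ p) with kid-at A (c ∘ inl) p
... | C , e , s , q , m = C , inl ∘ e , inl-subtree s , cong inl q , there m
kid-at (A ◁ B) c (graft refl _) = B , inr , inr-subtree , refl , here refl

module _ {C C′ T T′} {e : V C → V T} {e′ : V C′ → V T′} (s : IsSubtree e) (s′ : IsSubtree e′) where

  private
    descend : ∀ {σ} → IsIso σ → σ (e (root C)) ≡ e′ (root C′) → ∀ v → ∃ λ w → e′ w ≡ σ (e v)
    descend {σ} i r = V-induction C _ (root C′ , sym r)
      (λ { p (w , q) → S.down-closed s′ (subst (Par _) (sym q) (par⁺ i (S.par⁺ s p))) })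

  restrict-map : ∀ {σ} → IsIso σ → σ (e (root C)) ≡ e′ (root C′) → Σ (V C → V C′) λ τ → e′ ∘ τ ≗ σ ∘ e
  restrict-map i r = proj₁ ∘ descend i r , proj₂ ∘ descend i r

-- Once the top of one subtree goes to the top of the other, down-closure keeps the images of
-- children inside the target, so all of `C` follows. Running the same descent for the inverse of
-- `σ` gives surjectivity.
restrict : ∀ {C C′ T T′} {e : V C → V T} {e′ : V C′ → V T′} → IsSubtree e → IsSubtree e′ →
  ∀ {σ} → IsIso σ → σ (e (root C)) ≡ e′ (root C′) → Σ (V C → V C′) λ τ → IsIso τ × (e′ ∘ τ ≗ σ ∘ e)
restrict {C} {C′} {e = e} {e′} s s′ {σ} i r = τ , record
  { injective = λ p → S.injective s (injective i (trans (sym (τ≗ _)) (trans (cong e′ p) (τ≗ _))))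
  ; surjective = λ w → π w , S.injective s′ (trans (τ≗ _) (trans (cong σ (π≗ w)) (inverseʳ i _)))
  ; par⁺ = λ {u} {v} p → S.par⁻ s′ (subst₂ Par (sym (τ≗ u)) (sym (τ≗ v)) (par⁺ i (S.par⁺ s p)))
  ; par⁻ = λ {u} {v} p → S.par⁻ s (par⁻ i (subst₂ Par (τ≗ u) (τ≗ v) (S.par⁺ s′ p))) } , τ≗
  where
  forth = restrict-map s s′ i r
  τ = proj₁ forth
  τ≗ = proj₂ forth
  back = restrict-map s′ s (iso-inverse i) (trans (cong (inverse i) (sym r)) (inverseˡ i _))
  π = proj₁ back
  π≗ = proj₂ back

-- Distinguishing colourings of a grafted tree.

module _ {A B A′ B′} {τ : V A → V A′} {π : V B → V B′} where

  ◁-map : V (A ◁ B) → V (A′ ◁ B′)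
  ◁-map (inl v) = inl (τ v)
  ◁-map (inr v) = inr (π v)

  iso-◁ : IsIso τ → IsIso π → IsIso ◁-map
  iso-◁ i j = record
    { injective = inj
    ; surjective = λ { (inl w) → inl (inverse i w) , cong inl (inverseʳ i w)
                     ; (inr w) → inr (inverse j w) , cong inr (inverseʳ j w) }
    ; par⁺ = λ { (parˡ p) → parˡ (par⁺ i p) ; (parʳ p) → parʳ (par⁺ j p)
               ; (graft refl refl) → graft (iso-root j) (iso-root i) }
    ; par⁻ = λ {u} {v} → refl-par u v }
    where
    inj : ∀ {u v} → ◁-map u ≡ ◁-map v → u ≡ v
    inj {inl u} {inl v} p = cong inl (injective i (inl-injective p))
    inj {inr u} {inr v} p = cong inr (injective j (inr-injective p))
    refl-par : ∀ u v → Par (◁-map u) (◁-map v) → Par u v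
    refl-par (inl u) (inl v) (parˡ p) = parˡ (par⁻ i p)
    refl-par (inr u) (inr v) (parʳ p) = parʳ (par⁻ j p)
    refl-par (inr u) (inl v) (graft p q) =
      graft (injective j (trans p (sym (iso-root j)))) (injective i (trans q (sym (iso-root i))))

-- Transposes the last two children of the root, so that arguments about the last child reach the
-- earlier ones.
exchange : ∀ {A C B} → V (A ◁ C ◁ B) → V (A ◁ B ◁ C)
exchange (inl (inl v)) = inl (inl v)
exchange (inl (inr v)) = inr v
exchange (inr v) = inl (inr v)

exchange-involutive : ∀ {A C B} (v : V (A ◁ C ◁ B)) → exchange (exchange v) ≡ v
exchange-involutive (inl (inl v)) = refl
exchange-involutive (inl (inr v)) = refl
exchange-involutive (inr v) = refl

exchange-par : ∀ {A C B} {u v : V (A ◁ C ◁ B)} → Par u v → Par (exchange u) (exchange v)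
exchange-par (parˡ (parˡ p)) = parˡ (parˡ p)
exchange-par (parˡ (parʳ p)) = parʳ p
exchange-par (parˡ (graft p q)) = graft p (cong inl q)
exchange-par (parʳ p) = parˡ (parʳ p)
exchange-par (graft p refl) = parˡ (graft p refl)

iso-exchange : ∀ {A C B} → IsIso (exchange {A} {C} {B})
iso-exchange = record
  { injective = λ {u} {v} p → trans (sym (exchange-involutive u)) (trans (cong exchange p) (exchange-involutive v))
  ; surjective = λ w → exchange w , exchange-involutive w
  ; par⁺ = exchange-par
  ; par⁻ = λ {u} {v} p → subst₂ Par (exchange-involutive u) (exchange-involutive v) (exchange-par p) }

dist-left : ∀ {A B c} → Dist (A ◁ B , c) → Dist (A , c ∘ inl)
dist-left d τ i e v = inl-injective (d _ (iso-◁ i iso-id) (λ { (inl v) → e v ; (inr v) → refl }) (inl v))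

dist-right : ∀ {A B c} → Dist (A ◁ B , c) → Dist (B , c ∘ inr)
dist-right d τ i e v = inr-injective (d _ (iso-◁ iso-id i) (λ { (inl v) → refl ; (inr v) → e v }) (inr v))

-- If B is isomorphic to its sibling C, swapping the two is a nontrivial automorphism.
dist-fresh : ∀ A B c → Dist (A ◁ B , c) → Fresh (B , c ∘ inr) (kids A (c ∘ inl))
dist-fresh leaf B c d = []
dist-fresh (A ◁ C) B c d = not-swappable ∷
  dist-fresh A B (c ∘ exchange ∘ inl)
    (dist-left (dist-resp-ciso (ciso exchange iso-exchange (λ _ → refl)) d))
  where
  not-swappable : ¬ CIso (B , c ∘ inr) (C , c ∘ inl ∘ inr)
  not-swappable (ciso π i e) with d (exchange ∘ ◁-map {τ = ◁-map {τ = id} {inverse i}} {π})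
    (iso-∘ iso-exchange (iso-◁ (iso-◁ iso-id (iso-inverse i)) i))
    (λ { (inl (inl v)) → refl
       ; (inl (inr v)) → trans (sym (e _)) (cong (c ∘ inl ∘ inr) (inverseʳ i v))
       ; (inr v) → e v })
    (inr (root B))
  ... | ()

-- An automorphism sends the root of `B` to a child of the root. If that child is the root of `B`
-- itself, both halves are preserved and hence fixed; otherwise `B` would be isomorphic to an
-- earlier sibling, against freshness.
dist-◁ : ∀ A B c → Dist (A , c ∘ inl) → Dist (B , c ∘ inr) → Fresh (B , c ∘ inr) (kids A (c ∘ inl)) →
  Dist (A ◁ B , c)
dist-◁ A B c dA dB fr σ i e = fixed (subst (Par _) (iso-root i) (par⁺ i (graft refl refl)))
  where
  B-stays : σ (inr (root B)) ≡ inr (root B) → σ ≗ id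
  B-stays r with restrict inr-subtree inr-subtree i r
  ... | τ , j , τ≗ = λ
    { (inl v) → trans (sym (π≗ v)) (cong inl (dA π π-iso (λ v → trans (cong c (π≗ v)) (e _)) v))
    ; (inr v) → fix-B v }
    where
    fix-B : σ ∘ inr ≗ inr
    fix-B v = trans (sym (τ≗ v)) (cong inr (dB τ j (λ v → trans (cong c (τ≗ v)) (e _)) v))

    -- All of `B` is already fixed pointwise, so by injectivity no vertex of `A` can land there.
    left : ∀ v → ∃ λ w → inl w ≡ σ (inl v)
    left v with σ (inl v) in eq
    ... | inl w = w , refl
    ... | inr w with injective i (trans eq (sym (fix-B w)))
    ...   | ()

    π : V A → V A
    π = proj₁ ∘ left

    π≗ : inl ∘ π ≗ σ ∘ inl
    π≗ = proj₂ ∘ left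

    hit : ∀ w → ∃ λ v → π v ≡ w
    hit w with inverse i (inl w) in eq
    ... | inl v = v , inl-injective (trans (π≗ v) (trans (cong σ (sym eq)) (inverseʳ i _)))
    ... | inr v with trans (sym (fix-B v)) (trans (cong σ (sym eq)) (inverseʳ i (inl w)))
    ...   | ()

    π-iso : IsIso π
    π-iso = record
      { injective = λ p → inl-injective (injective i (trans (sym (π≗ _)) (trans (cong inl p) (π≗ _))))
      ; surjective = hit
      ; par⁺ = λ {u} {v} p → unl (subst₂ Par (sym (π≗ u)) (sym (π≗ v)) (par⁺ i (parˡ p)))
      ; par⁻ = λ {u} {v} p → unl (par⁻ i (subst₂ Par (π≗ u) (π≗ v) (parˡ {B = B} p))) }
      where
      unl : ∀ {u v} → Par (inl {A} {B} u) (inl v) → Par u v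
      unl (parˡ p) = p

  fixed : Par (σ (inr (root B))) (root (A ◁ B)) → σ ≗ id
  -- Within `B`, only its root is a child of the root of the whole tree.
  fixed h with σ (inr (root B)) in eq | h
  ... | inr w | graft refl _ = B-stays eq
  ... | inl w | parˡ p with kid-at A (c ∘ inl) p
  ...   | C , em , s , refl , m with restrict inr-subtree (inl-subtree s) i eq
  ...     | τ , j , τ≗ = ⊥-elim (All.lookup fr m (ciso τ j (λ v → trans (cong c (τ≗ v)) (e _))))

-- Listing colourings and isomorphisms, and deciding their properties.

-- Functions on vertices stored as nested pairs: pointwise equal tables are propositionally equal,
-- so colourings can be listed without repetition and counted.
Tab : Set → Tree → Set
Tab X leaf = X
Tab X (A ◁ B) = Tab X A × Tab X B

look : ∀ {X} t → Tab X t → V t → X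
look leaf x tip = x
look (A ◁ B) (f , g) (inl v) = look A f v
look (A ◁ B) (f , g) (inr v) = look B g v

tab : ∀ {X} t → (V t → X) → Tab X t
tab leaf f = f tip
tab (A ◁ B) f = tab A (f ∘ inl) , tab B (f ∘ inr)

look-tab : ∀ {X} t (f : V t → X) → look t (tab t f) ≗ f
look-tab leaf f tip = refl
look-tab (A ◁ B) f (inl v) = look-tab A (f ∘ inl) v
look-tab (A ◁ B) f (inr v) = look-tab B (f ∘ inr) v

tab-ext : ∀ {X} t {f g : Tab X t} → look t f ≗ look t g → f ≡ g
tab-ext leaf e = e tip
tab-ext (A ◁ B) e = cong₂ _,_ (tab-ext A (e ∘ inl)) (tab-ext B (e ∘ inr))

tab-≟ : ∀ t (f g : Tab ℕ t) → Dec (f ≡ g)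
tab-≟ leaf = ℕ._≟_
tab-≟ (A ◁ B) = ×-≡-dec (tab-≟ A) (tab-≟ B)

choices : ∀ {X} t → (V t → List X) → List (Tab X t)
choices leaf L = L tip
choices (A ◁ B) L = cartesianProduct (choices A (L ∘ inl)) (choices B (L ∘ inr))

∈-choices⁺ : ∀ {X} t {L : V t → List X} {f} → (∀ v → look t f v ∈ L v) → f ∈ choices t L
∈-choices⁺ leaf h = h tip
∈-choices⁺ (A ◁ B) h = ∈-cartesianProduct⁺ (∈-choices⁺ A (h ∘ inl)) (∈-choices⁺ B (h ∘ inr))

∈-choices⁻ : ∀ {X} t {L : V t → List X} {f} → f ∈ choices t L → ∀ v → look t f v ∈ L v
∈-choices⁻ leaf m tip = m
∈-choices⁻ (A ◁ B) m (inl v) = ∈-choices⁻ A (proj₁ (∈-cartesianProduct⁻ (choices A _) _ m)) v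
∈-choices⁻ (A ◁ B) m (inr v) = ∈-choices⁻ B (proj₂ (∈-cartesianProduct⁻ (choices A _) _ m)) v

choices-unique : ∀ {X} t {L : V t → List X} → (∀ v → Unique (L v)) → Unique (choices t L)
choices-unique leaf u = u tip
choices-unique (A ◁ B) u = Unique.cartesianProduct⁺ (choices-unique A (u ∘ inl)) (choices-unique B (u ∘ inr))

vertices : ∀ t → List (V t)
vertices leaf = tip ∷ []
vertices (A ◁ B) = map inl (vertices A) ++ map inr (vertices B)

∈-vertices : ∀ {t} (v : V t) → v ∈ vertices t
∈-vertices tip = here refl
∈-vertices (inl v) = ∈-++⁺ˡ (∈-map⁺ inl (∈-vertices v))
∈-vertices (inr v) = ∈-++⁺ʳ _ (∈-map⁺ inr (∈-vertices v))

vertices-unique : ∀ t → Unique (vertices t)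
vertices-unique leaf = [] ∷ []
vertices-unique (A ◁ B) = Unique.++⁺ (Unique.map⁺ inl-injective (vertices-unique A)) (Unique.map⁺ inr-injective (vertices-unique B))
  λ (p , q) → disjoint (∈-map⁻ inl p) (∈-map⁻ inr q)
  where
  disjoint : ∀ {w} → (∃ λ u → u ∈ vertices A × w ≡ inl u) → (∃ λ v → v ∈ vertices B × w ≡ inr v) → ⊥
  disjoint (_ , _ , refl) (_ , _ , ())

isos : ∀ A B → List (Tab (V B) A)
isos A B = filter (iso? ∘ look A) (choices A (λ _ → vertices B))

isos-unique : ∀ A B → Unique (isos A B)
isos-unique A B = Unique.filter⁺ (iso? ∘ look A) (choices-unique A (λ _ → vertices-unique B))

∈-isos⁺ : ∀ {A B} {τ : V A → V B} → IsIso τ → tab A τ ∈ isos A B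
∈-isos⁺ {A} {B} {τ} i = ∈-filter⁺ (iso? ∘ look A) (∈-choices⁺ A (λ _ → ∈-vertices _)) (iso-resp-≗ (sym ∘ look-tab A τ) i)

∈-isos⁻ : ∀ {A B π} → π ∈ isos A B → IsIso (look A π)
∈-isos⁻ {A} {B} m = proj₂ (∈-filter⁻ (iso? ∘ look A) {xs = choices A (λ _ → vertices B)} m)

ciso? : ∀ x y → Dec (CIso x y)
ciso? (A , c) (B , d) = map′
  (λ h → let (π , m , e) = find h in ciso (look A π) (∈-isos⁻ m) e)
  (λ (ciso τ i e) → lose (∈-isos⁺ i) (λ v → trans (cong d (look-tab A τ v)) (e v)))
  (Any.any? (λ π → all? A (λ v → d (look A π v) ℕ.≟ c v)) (isos A B))

dist? : ∀ x → Dec (Dist x)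
dist? (t , c) = map′
  (λ h τ i e v → trans (sym (look-tab t τ v)) (All.lookup h (∈-isos⁺ i) (λ v → trans (cong c (look-tab t τ v)) (e v)) v))
  (λ d → All.tabulate (λ m → d _ (∈-isos⁻ m)))
  (All.all? (λ π → all? t (λ v → c (look t π v) ℕ.≟ c v) →-dec all? t (λ v → look t π v ≟ v)) (isos t t))

fresh? : ∀ x → Decidable (Fresh x)
fresh? x = All.all? (¬? ∘ ciso? x)

-- c stays distinguishing when the coloured trees in X become further children of the root.
-- The context X lets the colour of a vertex in the last child be prescribed before the rest is coloured.
DistBeside : ∀ t → List ColoredTree → (V t → ℕ) → Set
DistBeside leaf X c = ⊤
DistBeside (A ◁ B) X c =
  DistBeside A X (c ∘ inl) × Dist (B , c ∘ inr) × Fresh (B , c ∘ inr) (kids A (c ∘ inl) ++ X)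

distBeside? : ∀ t X c → Dec (DistBeside t X c)
distBeside? leaf X c = yes tt
distBeside? (A ◁ B) X c = distBeside? A X (c ∘ inl) ×-dec dist? (B , c ∘ inr) ×-dec fresh? (B , c ∘ inr) _

dist⇒beside[] : ∀ t c → Dist (t , c) → DistBeside t [] c
dist⇒beside[] leaf c d = tt
dist⇒beside[] (A ◁ B) c d = dist⇒beside[] A (c ∘ inl) (dist-left d) , dist-right d , All.++⁺ (dist-fresh A B c d) []

beside[]⇒dist : ∀ t c → DistBeside t [] c → Dist (t , c)
beside[]⇒dist leaf c d τ i e tip with τ tip
... | tip = refl
beside[]⇒dist (A ◁ B) c (p , d , f) = dist-◁ A B c (beside[]⇒dist A _ p) d (All.++⁻ˡ (kids A (c ∘ inl)) f)

-- Non-isomorphism is symmetric, so a single extra sibling `x` in the context amounts to freshness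
-- of `x` against the children. This allows the last child to be coloured before the others.
beside[_]⁺ : ∀ x t c → DistBeside t [] c → Fresh x (kids t c) → DistBeside t (x ∷ []) c
beside[ x ]⁺ leaf c d f = tt
beside[ x ]⁺ (A ◁ B) c (p , d , g) (n ∷ f) =
  beside[ x ]⁺ A (c ∘ inl) p f , d , All.++⁺ (All.++⁻ˡ (kids A (c ∘ inl)) g) ((n ∘ ciso-sym) ∷ [])

beside[_]⁻ : ∀ x t c → DistBeside t (x ∷ []) c → DistBeside t [] c × Fresh x (kids t c)
beside[ x ]⁻ leaf c d = tt , []
beside[ x ]⁻ (A ◁ B) c (p , d , g) with beside[ x ]⁻ A (c ∘ inl) p | All.++⁻ (kids A (c ∘ inl)) g
... | q , f | g₁ , (n ∷ []) = (q , d , All.++⁺ g₁ []) , (n ∘ ciso-sym) ∷ f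

-- Colourings excluded by earlier siblings.

-- Transports each colouring in the family to `B` along every isomorphism; the results are exactly
-- the colourings of `B` isomorphic to a member of the family.
pulls : ∀ B → List ColoredTree → List (Tab ℕ B)
pulls B = concatMap λ (C , h) → map (λ π → tab B (h ∘ look B π)) (isos B C)

-- Taking uncoloured shapes as argument makes the number of excluded colourings independent of how
-- the siblings are coloured.
isoTotal : Tree → List Tree → ℕ
isoTotal B = sum ∘ map (length ∘ isos B)

length-pulls : ∀ B Z → length (pulls B Z) ≡ isoTotal B (map proj₁ Z)
length-pulls B [] = refl
length-pulls B ((C , h) ∷ Z) = trans (List.length-++ (map _ (isos B C))) (cong₂ _+_ (List.length-map _ (isos B C)) (length-pulls B Z))

∈-pulls⁺ : ∀ B Z {g} → Any (CIso (B , look B g)) Z → g ∈ pulls B Z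
∈-pulls⁺ B Z {g} = ∈-concatMap⁺ _ ∘ Any.map λ { {C , h} (ciso τ i e) →
  subst (_∈ _) (tab-ext B (λ v → trans (look-tab B _ v) (trans (cong h (look-tab B τ v)) (e v)))) (∈-map⁺ _ (∈-isos⁺ i)) }

∈-pulls⁻ : ∀ B Z {g} → g ∈ pulls B Z → Any (CIso (B , look B g)) Z
∈-pulls⁻ B Z m = Any.map (λ { {C , h} p → from-map h (∈-map⁻ _ p) }) (∈-concatMap⁻ _ {xs = Z} m)
  where
  from-map : ∀ {C g} (h : V C → ℕ) → (∃ λ π → π ∈ isos B C × g ≡ tab B (h ∘ look B π)) → CIso (B , look B g) (C , h)
  from-map h (π , m , refl) = ciso (look B π) (∈-isos⁻ m) (sym ∘ look-tab B _)

-- Two isomorphisms pulling `h` back to the same colouring differ by a colour-preserving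
-- automorphism of `C`, which is trivial. A colouring pulled from two members of `Z` would make
-- those members isomorphic.
pulls-unique : ∀ B {Z} → All Dist Z → AllPairs (λ x y → ¬ CIso x y) Z → Unique (pulls B Z)
pulls-unique B [] [] = []
pulls-unique B {(C , h) ∷ Z} (d ∷ ds) (n ∷ ns) = Unique.++⁺
  (map-unique (isos-unique B C) ∈-isos⁻)
  (pulls-unique B ds ns)
  λ (p , q) → let (z , z∈ , i) = find (∈-pulls⁻ B Z q) in
    All.lookup n z∈ (ciso-trans (ciso-sym (head-ciso (∈-pulls⁻ B ((C , h) ∷ []) (∈-++⁺ˡ p)))) i)
  where
  head-ciso : ∀ {P : ColoredTree → Set} {x} → Any P (x ∷ []) → P x
  head-ciso (here p) = p

  pull-injective : ∀ {π ρ} → IsIso (look B π) → IsIso (look B ρ) →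
    tab B (h ∘ look B π) ≡ tab B (h ∘ look B ρ) → π ≡ ρ
  pull-injective {π} {ρ} i j p = tab-ext B λ v →
    trans (cong (look B π) (sym (inverseˡ j v)))
      (d (look B π ∘ inverse j) (iso-∘ i (iso-inverse j))
        (λ w → trans (same (inverse j w)) (cong h (inverseʳ j w))) (look B ρ v))
    where
    same : h ∘ look B π ≗ h ∘ look B ρ
    same v = trans (sym (look-tab B _ v)) (trans (cong (λ f → look B f v) p) (look-tab B _ v))

  map-unique : ∀ {πs} → Unique πs → (∀ {π} → π ∈ πs → IsIso (look B π)) →
    Unique (map (λ π → tab B (h ∘ look B π)) πs)
  map-unique [] f = []
  map-unique (m ∷ u) f =
    All.map⁺ (All.tabulate (λ ρ∈ p → All.lookup m ρ∈ (pull-injective (f (here refl)) (f (there ρ∈)) p)))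
    ∷ map-unique u (f ∘ there)

distColorings : ∀ t → (V t → List ℕ) → List (Tab ℕ t)
distColorings t L = filter (λ f → dist? (t , look t f)) (choices t L)

∈-distColorings⁺ : ∀ t L {f} → (∀ v → look t f v ∈ L v) → Dist (t , look t f) → f ∈ distColorings t L
∈-distColorings⁺ t L h d = ∈-filter⁺ (λ f → dist? (t , look t f)) (∈-choices⁺ t h) d

∈-distColorings⁻ : ∀ t L {f} → f ∈ distColorings t L → (∀ v → look t f v ∈ L v) × Dist (t , look t f)
∈-distColorings⁻ t L m with ∈-filter⁻ (λ f → dist? (t , look t f)) m
... | p , d = ∈-choices⁻ t p , d

distColorings-unique : ∀ t {L} → (∀ v → Unique (L v)) → Unique (distColorings t L)
distColorings-unique t u = Unique.filter⁺ (λ f → dist? (t , look t f)) (choices-unique t u)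

-- The colourings of B isomorphic to z number at most the isomorphisms B → z, with equality if z is
-- distinguishing and the lists do not cut any of them off.
length-≤-isoTotal : ∀ B Z {gs} → Unique gs → (∀ {g} → g ∈ gs → Any (CIso (B , look B g)) Z) →
  length gs ≤ isoTotal B (map proj₁ Z)
length-≤-isoTotal B Z {gs} u h = subst (_ ≤_) (length-pulls B Z) (unique-⊆⇒length-≤ u (∈-pulls⁺ B Z ∘ h))

isoTotal-≤-length : ∀ B Z {gs} → All Dist Z → AllPairs (λ x y → ¬ CIso x y) Z →
  (∀ {g} → Any (CIso (B , look B g)) Z → g ∈ gs) → isoTotal B (map proj₁ Z) ≤ length gs
isoTotal-≤-length B Z d n h = subst (_≤ _) (length-pulls B Z) (unique-⊆⇒length-≤ (pulls-unique B d n) (h ∘ ∈-pulls⁻ B Z))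

freshColorings : ∀ B → (V B → List ℕ) → List ColoredTree → List (Tab ℕ B)
freshColorings B L Z = filter (λ g → fresh? (B , look B g) Z) (distColorings B L)

staleColorings : ∀ B → (V B → List ℕ) → List ColoredTree → List (Tab ℕ B)
staleColorings B L Z = filter (λ g → ¬? (fresh? (B , look B g) Z)) (distColorings B L)

private
  fresh≡ : ∀ B L Z → length (freshColorings B L Z) ≡ length (distColorings B L) ∸ length (staleColorings B L Z)
  fresh≡ B L Z = trans (sym (ℕ.m+n∸n≡m _ (length (staleColorings B L Z))))
    (cong (_∸ length (staleColorings B L Z)) (length-filter-split (λ g → fresh? (B , look B g) Z) (distColorings B L)))

-- A stale colouring is isomorphic to a member of `Z`, so `isoTotal` bounds how many are lost,
-- whatever the lists are.
freshColorings-≥ : ∀ B L Z → (∀ v → Unique (L v)) →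
  length (distColorings B L) ∸ isoTotal B (map proj₁ Z) ≤ length (freshColorings B L Z)
freshColorings-≥ B L Z u = subst ((length (distColorings B L) ∸ isoTotal B (map proj₁ Z)) ≤_) (sym (fresh≡ B L Z)) (ℕ.∸-monoʳ-≤ (length (distColorings B L))
  (length-≤-isoTotal B Z (Unique.filter⁺ stale? (distColorings-unique B u))
    (λ m → ¬fresh⇒any (proj₂ (∈-filter⁻ stale? {xs = distColorings B L} m)))))
  where
  stale? = λ g → ¬? (fresh? (B , look B g) Z)
  ¬fresh⇒any : ∀ {x} → ¬ Fresh x Z → Any (CIso x) Z
  ¬fresh⇒any {x} n with Any.any? (ciso? x) Z
  ... | yes p = p
  ... | no ¬p = ⊥-elim (n (All.¬Any⇒All¬ Z ¬p))

-- Conditions under which exactly `isoTotal` many `K`-colourings are excluded: no pulled-back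
-- colouring occurs twice, and none leaves the list `K`.
record Rainbow (K : List ℕ) (Z : List ColoredTree) : Set where
  field
    dist     : All Dist Z
    distinct : AllPairs (λ x y → ¬ CIso x y) Z
    colors   : All (λ z → ∀ v → proj₂ z v ∈ K) Z

open Rainbow

freshColorings-≤ : ∀ B K Z → Rainbow K Z →
  length (freshColorings B (λ _ → K) Z) ≤ length (distColorings B (λ _ → K)) ∸ isoTotal B (map proj₁ Z)
freshColorings-≤ B K Z r = subst (_≤ length (distColorings B (λ _ → K)) ∸ isoTotal B (map proj₁ Z)) (sym (fresh≡ B (λ _ → K) Z)) (ℕ.∸-monoʳ-≤ (length (distColorings B (λ _ → K)))
  (isoTotal-≤-length B Z (dist r) (distinct r) λ a →
    let (z , z∈ , i@(ciso τ _ e)) = find a in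
    ∈-filter⁺ (λ g → ¬? (fresh? (B , look B g) Z))
      (∈-distColorings⁺ B (λ _ → K) (λ v → subst (_∈ K) (e v) (All.lookup (colors r) z∈ (τ v)))
        (dist-resp-ciso i (All.lookup (dist r) z∈)))
      (λ f → All.All¬⇒¬Any f a)))

-- Greedy comparison of arbitrary lists with a constant list.

besideColorings : ∀ t → List ColoredTree → (V t → List ℕ) → List (Tab ℕ t)
besideColorings t X L = filter (λ f → distBeside? t X (look t f)) (choices t L)

kids-rainbow : ∀ t {K X c} → Rainbow K X → (∀ v → c v ∈ K) → DistBeside t X c → Rainbow K (kids t c ++ X)
kids-rainbow leaf r m d = r
kids-rainbow (A ◁ B) r m (p , d , f) = record
  { dist = d ∷ dist r′ ; distinct = f ∷ distinct r′ ; colors = (m ∘ inr) ∷ colors r′ }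
  where r′ = kids-rainbow A r (m ∘ inl) p

kids-shapes : ∀ t c d → map proj₁ (kids t c) ≡ map proj₁ (kids t d)
kids-shapes leaf c d = refl
kids-shapes (A ◁ B) c d = cong (B ∷_) (kids-shapes A (c ∘ inl) (d ∘ inl))

kids-++-shapes : ∀ t c d {X Y} → map proj₁ X ≡ map proj₁ Y → map proj₁ (kids t c ++ X) ≡ map proj₁ (kids t d ++ Y)
kids-++-shapes t c d {X} {Y} e = trans (List.map-++ proj₁ (kids t c) X)
  (trans (cong₂ _++_ (kids-shapes t c d) e) (sym (List.map-++ proj₁ (kids t d) Y)))

length-distColorings : ∀ t L → length (distColorings t L) ≡ length (besideColorings t [] L)
length-distColorings t L = cong length
  (List.filter-≐ _ _ ((λ {f} → dist⇒beside[] t (look t f)) , (λ {f} → beside[]⇒dist t (look t f))) (choices t L))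

Lists : ℕ → ∀ t → (V t → List ℕ) → Set
Lists k t L = ∀ v → Unique (L v) × length (L v) ≡ k

length-fibre : ∀ A B X L f → DistBeside A X (look A f) →
  length (freshColorings B L (kids A (look A f) ++ X))
  ≡ length (filter (λ g → distBeside? (A ◁ B) X (look (A ◁ B) (f , g))) (choices B L))
length-fibre A B X L f d = length-filter-filter _ _ _ proj₂ (λ p q → d , p , q) (choices B L)

mutual

  -- Over each admissible colouring of `A` there are at most `q` extensions to `B` from `K` and at
  -- least `q` from `L`. As `q` depends on shapes only, the contexts `X` and `Y` may be coloured
  -- differently.
  besideColorings-≤ : ∀ t K {L} → Lists (length K) t L → ∀ {X Y} → map proj₁ X ≡ map proj₁ Y → Rainbow K Y →
    length (besideColorings t Y (λ _ → K)) ≤ length (besideColorings t X L)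
  besideColorings-≤ leaf K {L} l {X} {Y} e r = ℕ.≤-reflexive (trans
    (cong length (List.filter-all (λ f → distBeside? leaf Y (look leaf f)) {K} (All.universal (λ _ → tt) K)))
    (trans (sym (proj₂ (l tip)))
      (sym (cong length (List.filter-all (λ f → distBeside? leaf X (look leaf f)) {L tip} (All.universal (λ _ → tt) (L tip)))))))
  besideColorings-≤ (A ◁ B) K {L} l {X} {Y} e r = begin
    length (besideColorings (A ◁ B) Y (λ _ → K))
      ≤⟨ filter-product-≤ (distBeside? (A ◁ B) Y ∘ look (A ◁ B)) (distBeside? A Y ∘ look A) _ (choices A (λ _ → K)) _ proj₁ upper ⟩
    length (besideColorings A Y (λ _ → K)) * q
      ≤⟨ ℕ.*-monoˡ-≤ q (besideColorings-≤ A K (l ∘ inl) e r) ⟩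
    length (besideColorings A X (L ∘ inl)) * q
      ≤⟨ filter-product-≥ (distBeside? (A ◁ B) X ∘ look (A ◁ B)) (distBeside? A X ∘ look A) _ (choices A (L ∘ inl)) _ lower ⟩
    length (besideColorings (A ◁ B) X L) ∎
    where
    open ℕ.≤-Reasoning
    -- The colour 0 is a placeholder: only the shapes of the children survive.
    Y-shapes = map proj₁ (kids A (λ _ → 0) ++ Y)
    q = length (distColorings B (λ _ → K)) ∸ isoTotal B Y-shapes

    upper : ∀ f → f ∈ choices A (λ _ → K) → DistBeside A Y (look A f) →
      length (filter (λ g → distBeside? (A ◁ B) Y (look (A ◁ B) (f , g))) (choices B (λ _ → K))) ≤ q
    upper f m d = begin
      _ ≡⟨ length-fibre A B Y (λ _ → K) f d ⟨
      length (freshColorings B (λ _ → K) (kids A (look A f) ++ Y))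
        ≤⟨ freshColorings-≤ B K _ (kids-rainbow A r (∈-choices⁻ A m) d) ⟩
      length (distColorings B (λ _ → K)) ∸ isoTotal B (map proj₁ (kids A (look A f) ++ Y))
        ≡⟨ cong (λ ss → length (distColorings B (λ _ → K)) ∸ isoTotal B ss) (kids-++-shapes A _ _ refl) ⟩
      q ∎

    lower : ∀ f → f ∈ choices A (L ∘ inl) → DistBeside A X (look A f) →
      q ≤ length (filter (λ g → distBeside? (A ◁ B) X (look (A ◁ B) (f , g))) (choices B (L ∘ inr)))
    lower f m d = begin
      q
        ≡⟨ cong (λ ss → length (distColorings B (λ _ → K)) ∸ isoTotal B ss) (kids-++-shapes A _ _ (sym e)) ⟩
      length (distColorings B (λ _ → K)) ∸ isoTotal B (map proj₁ (kids A (look A f) ++ X))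
        ≤⟨ freshColorings-mono B K (l ∘ inr) _ ⟩
      length (freshColorings B (L ∘ inr) (kids A (look A f) ++ X))
        ≡⟨ length-fibre A B X (L ∘ inr) f d ⟩
      _ ∎

  freshColorings-mono : ∀ B K {L} → Lists (length K) B L → ∀ Z →
    length (distColorings B (λ _ → K)) ∸ isoTotal B (map proj₁ Z) ≤ length (freshColorings B L Z)
  freshColorings-mono B K {L} l Z = ℕ.≤-trans
    (ℕ.∸-monoˡ-≤ (isoTotal B (map proj₁ Z)) (distColorings-≤ B K l))
    (freshColorings-≥ B L Z (proj₁ ∘ l))

  distColorings-≤ : ∀ t K {L} → Lists (length K) t L → length (distColorings t (λ _ → K)) ≤ length (distColorings t L)
  distColorings-≤ t K {L} l rewrite length-distColorings t (λ _ → K) | length-distColorings t L =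
    besideColorings-≤ t K l {[]} {[]} refl (record { dist = [] ; distinct = [] ; colors = [] })

nonempty : ∀ {X : Set} {xs : List X} → 0 < length xs → ∃ (_∈ xs)
nonempty {xs = x ∷ xs} _ = x , here refl

-- The half containing `v` is coloured first, with `c` at `v` by induction. The given `K`-colouring
-- shows that the greedy bounds are positive, which leaves a choice for the other half.
color-attained : ∀ t K {L} → Lists (length K) t L → ∃ (_∈ distColorings t (λ _ → K)) →
  ∀ v {c} → c ∈ L v → ∃ λ f → f ∈ distColorings t L × look t f v ≡ c
color-attained leaf K {L} l _ tip {c} m =
  c , ∈-distColorings⁺ leaf L (λ { tip → m }) (beside[]⇒dist leaf _ tt) , refl
color-attained (A ◁ B) K {L} l ((f₀ , g₀) , m₀) v {c} m = at v m
  where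
  f₀∈ : ∀ v → look A f₀ v ∈ K
  f₀∈ = proj₁ (∈-distColorings⁻ (A ◁ B) (λ _ → K) m₀) ∘ inl

  g₀∈ : ∀ v → look B g₀ v ∈ K
  g₀∈ = proj₁ (∈-distColorings⁻ (A ◁ B) (λ _ → K) m₀) ∘ inr

  d₀ : Dist (A ◁ B , look (A ◁ B) (f₀ , g₀))
  d₀ = proj₂ (∈-distColorings⁻ (A ◁ B) (λ _ → K) m₀)

  beside₀ : DistBeside A [] (look A f₀)
  beside₀ = dist⇒beside[] A (look A f₀) (dist-left d₀)

  fresh₀ : Fresh (B , look B g₀) (kids A (look A f₀))
  fresh₀ = dist-fresh A B (look (A ◁ B) (f₀ , g₀)) d₀

  g₀-dist : g₀ ∈ distColorings B (λ _ → K)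
  g₀-dist = ∈-distColorings⁺ B (λ _ → K) g₀∈ (dist-right d₀)

  combine : ∀ {f g} → f ∈ distColorings A (L ∘ inl) → g ∈ distColorings B (L ∘ inr) →
    Fresh (B , look B g) (kids A (look A f)) → (f , g) ∈ distColorings (A ◁ B) L
  combine {f} {g} f∈ g∈ fr =
    let (mf , df) = ∈-distColorings⁻ A (L ∘ inl) f∈
        (mg , dg) = ∈-distColorings⁻ B (L ∘ inr) g∈
    in ∈-distColorings⁺ (A ◁ B) L (λ { (inl v) → mf v ; (inr v) → mg v })
         (dist-◁ A B (look (A ◁ B) (f , g)) df dg fr)

  -- The colouring `g₀` is fresh beside `f₀`, so the bound for `K` is positive; it is the same
  -- beside `f`, whose children have the same shapes.
  extend-left : ∀ f → ∃ λ g → g ∈ distColorings B (L ∘ inr) × Fresh (B , look B g) (kids A (look A f))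
  extend-left f =
    let (g , g∈) = nonempty (ℕ.≤-trans (ℕ.≤-trans (∈-length g₀-fresh) upper) (freshColorings-mono B K (l ∘ inr) (kids A (look A f) ++ [])))
        (g∈′ , fr) = ∈-filter⁻ (λ g → fresh? (B , look B g) (kids A (look A f) ++ [])) {xs = distColorings B (L ∘ inr)} g∈
    in g , g∈′ , All.++⁻ˡ (kids A (look A f)) fr
    where
    g₀-fresh : g₀ ∈ freshColorings B (λ _ → K) (kids A (look A f₀) ++ [])
    g₀-fresh = ∈-filter⁺ (λ g → fresh? (B , look B g) (kids A (look A f₀) ++ [])) g₀-dist (All.++⁺ fresh₀ [])

    upper : length (freshColorings B (λ _ → K) (kids A (look A f₀) ++ []))
      ≤ length (distColorings B (λ _ → K)) ∸ isoTotal B (map proj₁ (kids A (look A f) ++ []))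
    upper = subst (λ ss → length (freshColorings B (λ _ → K) (kids A (look A f₀) ++ [])) ≤ length (distColorings B (λ _ → K)) ∸ isoTotal B ss)
      (kids-++-shapes A (look A f₀) (look A f) {[]} {[]} refl)
      (freshColorings-≤ B K (kids A (look A f₀) ++ []) (kids-rainbow A (record { dist = [] ; distinct = [] ; colors = [] }) f₀∈ beside₀))

  -- Now `B` is coloured already and serves as context for `A`. The contexts given by `g` and `g₀`
  -- have the same shape, so the witness `f₀` for `K` yields one for `L`.
  extend-right : ∀ g → ∃ λ f → f ∈ distColorings A (L ∘ inl) × Fresh (B , look B g) (kids A (look A f))
  extend-right g =
    let (f , f∈) = nonempty (ℕ.≤-trans (∈-length f₀-beside) (besideColorings-≤ A K (l ∘ inl) {(B , look B g) ∷ []} {(B , look B g₀) ∷ []} refl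
          (record { dist = dist-right d₀ ∷ [] ; distinct = [] ∷ [] ; colors = g₀∈ ∷ [] })))
        (f∈′ , d) = ∈-filter⁻ (λ f → distBeside? A ((B , look B g) ∷ []) (look A f)) {xs = choices A (L ∘ inl)} f∈
        (d′ , fr) = beside[ B , look B g ]⁻ A (look A f) d
    in f , ∈-distColorings⁺ A (L ∘ inl) (∈-choices⁻ A f∈′) (beside[]⇒dist A (look A f) d′) , fr
    where
    f₀-beside : f₀ ∈ besideColorings A ((B , look B g₀) ∷ []) (λ _ → K)
    f₀-beside = ∈-filter⁺ (λ f → distBeside? A ((B , look B g₀) ∷ []) (look A f)) (∈-choices⁺ A f₀∈)
      (beside[ B , look B g₀ ]⁺ A (look A f₀) beside₀ fresh₀)

  at : ∀ v → c ∈ L v → ∃ λ f → f ∈ distColorings (A ◁ B) L × look (A ◁ B) f v ≡ c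
  at (inl v) m =
    let (f , f∈ , e) = color-attained A K (l ∘ inl) (f₀ , ∈-distColorings⁺ A (λ _ → K) f₀∈ (dist-left d₀)) v m
        (g , g∈ , fr) = extend-left f
    in (f , g) , combine f∈ g∈ fr , e
  at (inr v) m =
    let (g , g∈ , e) = color-attained B K (l ∘ inr) (g₀ , g₀-dist) v m
        (f , f∈ , fr) = extend-right g
    in (f , g) , combine f∈ g∈ fr , e

-- Enlarging a tree by a new leaf below a given vertex.

insert : ∀ t → V t → Tree
insert leaf tip = leaf ◁ leaf
insert (A ◁ B) (inl p) = insert A p ◁ B
insert (A ◁ B) (inr p) = A ◁ insert B p

-- nothing stands for the inserted leaf.
old : ∀ t p → V (insert t p) → Maybe (V t)
old leaf tip (inl tip) = just tip
old leaf tip (inr tip) = nothing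
old (A ◁ B) (inl p) (inl v) = Maybe.map inl (old A p v)
old (A ◁ B) (inl p) (inr v) = just (inr v)
old (A ◁ B) (inr p) (inl v) = just (inl v)
old (A ◁ B) (inr p) (inr v) = Maybe.map inr (old B p v)

map-inl-injective : ∀ {A B} {x y : Maybe (V A)} → Maybe.map (inl {A} {B}) x ≡ Maybe.map inl y → x ≡ y
map-inl-injective = Maybe.map-injective inl-injective

map-inr-injective : ∀ {A B} {x y : Maybe (V B)} → Maybe.map (inr {A} {B}) x ≡ Maybe.map inr y → x ≡ y
map-inr-injective = Maybe.map-injective inr-injective

map-inl≢inr : ∀ {A B} (x : Maybe (V A)) {v : V B} → Maybe.map inl x ≢ just (inr v)
map-inl≢inr nothing ()
map-inl≢inr (just _) ()

map-inr≢inl : ∀ {A B} (x : Maybe (V B)) {v : V A} → Maybe.map inr x ≢ just (inl v)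
map-inr≢inl nothing ()
map-inr≢inl (just _) ()

old-injective : ∀ t p {u v} → old t p u ≡ old t p v → u ≡ v
old-injective leaf tip {inl tip} {inl tip} e = refl
old-injective leaf tip {inr tip} {inr tip} e = refl
old-injective leaf tip {inl tip} {inr tip} ()
old-injective leaf tip {inr tip} {inl tip} ()
old-injective (A ◁ B) (inl p) {inl u} {inl v} e = cong inl (old-injective A p (map-inl-injective e))
old-injective (A ◁ B) (inl p) {inl u} {inr v} e = ⊥-elim (map-inl≢inr (old A p u) e)
old-injective (A ◁ B) (inl p) {inr u} {inl v} e = ⊥-elim (map-inl≢inr (old A p v) (sym e))
old-injective (A ◁ B) (inl p) {inr u} {inr v} refl = refl
old-injective (A ◁ B) (inr p) {inl u} {inl v} refl = refl
old-injective (A ◁ B) (inr p) {inl u} {inr v} e = ⊥-elim (map-inr≢inl (old B p v) (sym e))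
old-injective (A ◁ B) (inr p) {inr u} {inl v} e = ⊥-elim (map-inr≢inl (old B p u) e)
old-injective (A ◁ B) (inr p) {inr u} {inr v} e = cong inr (old-injective B p (map-inr-injective e))

old-root : ∀ t p → old t p (root (insert t p)) ≡ just (root t)
old-root leaf tip = refl
old-root (A ◁ B) (inl p) = cong (Maybe.map inl) (old-root A p)
old-root (A ◁ B) (inr p) = refl

data OldPar {t} (p : V t) : Maybe (V t) → Maybe (V t) → Set where
  kept  : ∀ {u v} → Par u v → OldPar p (just u) (just v)
  added : OldPar p nothing (just p)

old-par : ∀ t p {u v} → Par u v → OldPar p (old t p u) (old t p v)
old-par leaf tip (graft {u = tip} {tip} _ _) = added
old-par (A ◁ B) (inl p) (parˡ {u = u} {v} q) with old A p u | old A p v | old-par A p q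
... | _ | _ | kept r = kept (parˡ r)
... | _ | _ | added = added
old-par (A ◁ B) (inl p) (parʳ q) = kept (parʳ q)
old-par (A ◁ B) (inl p) (graft q refl) rewrite old-root A p = kept (graft q refl)
old-par (A ◁ B) (inr p) (parˡ q) = kept (parˡ q)
old-par (A ◁ B) (inr p) (parʳ {u = u} {v} q) with old B p u | old B p v | old-par B p q
... | _ | _ | kept r = kept (parʳ r)
... | _ | _ | added = added
old-par (A ◁ B) (inr p) (graft refl q) rewrite old-root B p = kept (graft refl q)

size : Tree → ℕ
size t = length (vertices t)

size-◁ : ∀ A B → size (A ◁ B) ≡ size A + size B
size-◁ A B = trans (List.length-++ (map inl (vertices A)))
  (cong₂ _+_ (List.length-map inl (vertices A)) (List.length-map inr (vertices B)))

size-insert : ∀ t p → size (insert t p) ≡ suc (size t)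
size-insert leaf tip = refl
size-insert (A ◁ B) (inl p) rewrite size-◁ (insert A p) B | size-◁ A B = cong (_+ size B) (size-insert A p)
size-insert (A ◁ B) (inr p) rewrite size-◁ A (insert B p) | size-◁ A B =
  trans (cong (size A +_) (size-insert B p)) (ℕ.+-suc _ _)

-- Realising a tree given by a parent map as a grafted tree.

module _ {n : ℕ} (T : RootedTree n) where
  open RootedTree T using (parent; parent-root; reaches-root) renaming (root to rootT)

  -- A partial model of `T`: the image of `φ` contains the root and is closed under `parent`.
  record Embedding : Set where
    field
      tree      : Tree
      φ         : V tree → Fin n
      φ-inj     : ∀ {u v} → φ u ≡ φ v → u ≡ v
      φ-root    : φ (root tree) ≡ rootT
      φ-par     : ∀ {u v} → Par u v → parent (φ u) ≡ φ v

  open Embedding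

  size-≤ : ∀ E → size (tree E) ≤ n
  size-≤ E = subst₂ _≤_ (List.length-map (φ E) (vertices (tree E))) (List.length-tabulate id)
    (unique-⊆⇒length-≤ (Unique.map⁺ (φ-inj E) (vertices-unique (tree E))) (λ _ → ∈-allFin _))

  extend : ∀ E p x → (∀ v → φ E v ≢ x) → parent x ≡ φ E p → Embedding
  extend E p x new px = record
    { tree = insert t p ; φ = ψ ∘ old t p
    ; φ-inj = old-injective t p ∘ ψ-inj
    ; φ-root = trans (cong ψ (old-root t p)) (φ-root E)
    ; φ-par = ψ-par ∘ old-par t p }
    where
    t = tree E
    ψ : Maybe (V t) → Fin n
    ψ = Maybe.maybe′ (φ E) x
    ψ-inj : ∀ {u v} → ψ u ≡ ψ v → u ≡ v
    ψ-inj {just u} {just v} e = cong just (φ-inj E e)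
    ψ-inj {just u} {nothing} e = ⊥-elim (new u e)
    ψ-inj {nothing} {just v} e = ⊥-elim (new v (sym e))
    ψ-inj {nothing} {nothing} e = refl
    ψ-par : ∀ {u v} → OldPar p u v → parent (ψ u) ≡ ψ v
    ψ-par (kept q) = φ-par E q
    ψ-par added = px

  Hit : Embedding → Fin n → Set
  Hit E x = ∃ λ v → φ E v ≡ x

  hit? : ∀ E → Decidable (Hit E)
  hit? E x = any? (tree E) (λ v → φ E v Fin.≟ x)

  -- The path from an unhit vertex up to the root must enter the image somewhere; the last vertex
  -- before entry can be attached as a leaf.
  frontier : ∀ E x → ¬ Hit E x → ∀ m → Hit E (iter parent m x) → ∃ λ y → ¬ Hit E y × Hit E (parent y)
  frontier E x ¬h zero h = ⊥-elim (¬h h)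
  frontier E x ¬h (suc m) h with hit? E (iter parent m x)
  ... | yes h′ = frontier E x ¬h m h′
  ... | no ¬h′ = iter parent m x , ¬h′ , h

  -- Here `m` bounds the number of leaves still to be added, each of which enlarges the tree by one.
  complete : ∀ m E → n ≤ m + size (tree E) → ∃ λ E → ∀ x → Hit E x
  complete m E le with Fin.all? (hit? E)
  ... | yes h = E , h
  ... | no ¬h with Fin.¬∀⟶∃¬ n (Hit E) (hit? E) ¬h
  ...   | x , ¬hx with frontier E x ¬hx (proj₁ (reaches-root x)) (root (tree E) , trans (φ-root E) (sym (proj₂ (reaches-root x))))
  ...     | y , ¬hy , p , q = continue m le
    where
    E′ = extend E p y (λ v e → ¬hy (v , e)) (sym q)
    continue : ∀ m → n ≤ m + size (tree E) → ∃ λ E → ∀ x → Hit E x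
    -- The enlarged tree would inject more than `n` vertices into `Fin n`.
    continue zero le = ⊥-elim (ℕ.<-irrefl refl (ℕ.≤-trans (subst (_≤ n) (size-insert (tree E) p) (size-≤ E′)) le))
    continue (suc m) le = complete m E′ (subst (n ≤_) (trans (sym (ℕ.+-suc m _)) (cong (m +_) (sym (size-insert (tree E) p)))) le)

  model : ∃ λ E → ∀ x → Hit E x
  model = complete n (record
    { tree = leaf ; φ = λ _ → rootT ; φ-inj = λ { {tip} {tip} _ → refl } ; φ-root = refl ; φ-par = λ () }) (ℕ.m≤m+n n _)

  -- Translation between the parent-map tree and its grafted model.

  module Bridge (E : Embedding) (onto : ∀ x → Hit E x) where

    t : Tree
    t = tree E

    ψ : Fin n → V t
    ψ = proj₁ ∘ onto

    φψ : ∀ x → φ E (ψ x) ≡ x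
    φψ = proj₂ ∘ onto

    ψφ : ∀ v → ψ (φ E v) ≡ v
    ψφ v = φ-inj E (φψ (φ E v))

    adj⁺ : ∀ {u v} → Par u v ⊎ Par v u → Adj T (φ E u) (φ E v)
    adj⁺ {u} {v} (inj₁ p) = (λ e → par-asym p (subst₂ Par (φ-inj E e) (sym (φ-inj E e)) p)) , inj₁ (φ-par E p)
    adj⁺ {u} {v} (inj₂ p) = (λ e → par-asym p (subst₂ Par (sym (φ-inj E e)) (φ-inj E e) p)) , inj₂ (φ-par E p)

    parent⁻ : ∀ {u v} → φ E u ≢ φ E v → parent (φ E u) ≡ φ E v → Par u v
    parent⁻ {u} {v} ne e with root-or-child u
    -- The root is its own parent in `T`; this loop is not an edge and is excluded by `ne`.
    ... | inj₁ refl = ⊥-elim (ne (trans (φ-root E) (trans (sym parent-root) (trans (cong parent (sym (φ-root E))) e))))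
    ... | inj₂ (w , p) = subst (Par u) (φ-inj E (trans (sym (φ-par E p)) e)) p

    adj⁻ : ∀ {u v} → Adj T (φ E u) (φ E v) → Par u v ⊎ Par v u
    adj⁻ (ne , inj₁ e) = inj₁ (parent⁻ ne e)
    adj⁻ (ne , inj₂ e) = inj₂ (parent⁻ (ne ∘ sym) e)

    aut⇒iso : ∀ {σ} → IsAut T σ → IsIso (ψ ∘ σ ∘ φ E)
    aut⇒iso {σ} ((inj , surj) , fix , adj) = record
      { injective = τ-inj
      ; surjective = λ w → let (x , q) = surj (φ E w) in ψ x , trans (cong ψ (trans (cong σ (φψ x)) (q refl))) (ψφ w)
      ; par⁺ = λ {_} {v} p → down v p
      ; par⁻ = up }
      where
      τ : V t → V t
      τ = ψ ∘ σ ∘ φ E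
      φτ : ∀ v → φ E (τ v) ≡ σ (φ E v)
      φτ v = φψ (σ (φ E v))
      τ-inj : ∀ {u v} → τ u ≡ τ v → u ≡ v
      τ-inj e = φ-inj E (inj (trans (sym (φτ _)) (trans (cong (φ E) e) (φτ _))))
      τ-root : τ (root t) ≡ root t
      τ-root = φ-inj E (trans (φτ _) (trans (cong σ (φ-root E)) (trans fix (sym (φ-root E)))))
      τ-adj : ∀ {u v} → Par u v → Par (τ u) (τ v) ⊎ Par (τ v) (τ u)
      τ-adj {u} {v} p = adj⁻ (subst₂ (Adj T) (sym (φτ u)) (sym (φτ v)) (Equivalence.to (adj _ _) (adj⁺ (inj₁ p))))
      -- Edges cannot be reversed: by induction from the root, the parent of v already goes to the parent of τ v.
      down : ∀ v {u} → Par u v → Par (τ u) (τ v)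
      down = V-induction t (λ v → ∀ {u} → Par u v → Par (τ u) (τ v)) at-root below
        where
        at-root : ∀ {u} → Par u (root t) → Par (τ u) (τ (root t))
        at-root {u} p with τ-adj p
        ... | inj₁ q = q
        ... | inj₂ q = ⊥-elim (root-no-parent t (subst (λ z → Par z (τ u)) τ-root q))
        below : ∀ {v w} → Par v w → (∀ {u} → Par u w → Par (τ u) (τ w)) → ∀ {u} → Par u v → Par (τ u) (τ v)
        below q h {u} p with τ-adj p
        ... | inj₁ r = r
        ... | inj₂ r with τ-inj (par-functional r (h q))
        ...   | refl = ⊥-elim (par-asym p q)
      up : ∀ {u v} → Par (τ u) (τ v) → Par u v
      up {u} {v} p with adj⁻ (Equivalence.from (adj _ _) (subst₂ (Adj T) (φτ u) (φτ v) (adj⁺ (inj₁ p))))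
      ... | inj₁ q = q
      ... | inj₂ q = ⊥-elim (par-asym p (down _ q))

    iso⇒aut : ∀ {τ} → IsIso τ → IsAut T (φ E ∘ τ ∘ ψ)
    iso⇒aut {τ} i =
      ( (λ e → trans (sym (φψ _)) (trans (cong (φ E) (injective i (φ-inj E e))) (φψ _)))
      , (λ y → φ E (inverse i (ψ y)) , λ { refl → trans (cong (φ E ∘ τ) (ψφ _)) (trans (cong (φ E) (inverseʳ i _)) (φψ y)) }))
      , trans (cong (φ E ∘ τ) (φ-inj E (trans (φψ _) (sym (φ-root E))))) (trans (cong (φ E) (iso-root i)) (φ-root E))
      , λ u v → mk⇔
        (λ a → adj⁺ (Sum.map (par⁺ i) (par⁺ i) (adj⁻ (subst₂ (Adj T) (sym (φψ u)) (sym (φψ v)) a))))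
        (λ a → subst₂ (Adj T) (φψ u) (φψ v) (adj⁺ (Sum.map (par⁻ i) (par⁻ i) (adj⁻ a))))

    equivalent⇒ciso : ∀ c d → Equivalent T c d → CIso (t , c ∘ φ E) (t , d ∘ φ E)
    equivalent⇒ciso c d (σ , a , e) = ciso _ (aut⇒iso a) λ v → trans (cong d (φψ _)) (sym (e _))

    ciso⇒equivalent : ∀ c d → CIso (t , c ∘ φ E) (t , d ∘ φ E) → Equivalent T c d
    ciso⇒equivalent c d (ciso τ i e) = _ , iso⇒aut i , λ u → sym (trans (e _) (cong c (φψ u)))

    distinguishing⇒dist : ∀ {c} → IsDistinguishing T c → Dist (t , c ∘ φ E)
    distinguishing⇒dist {c} d τ i e v = φ-inj E (trans (cong (φ E ∘ τ) (sym (ψφ v)))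
      (d _ (iso⇒aut i) (λ x → trans (e _) (cong c (φψ x))) (φ E v)))

    dist⇒distinguishing : ∀ {c} → Dist (t , c ∘ φ E) → IsDistinguishing T c
    dist⇒distinguishing {c} d σ a e x = trans (cong σ (sym (φψ x))) (trans (sym (φψ _))
      (trans (cong (φ E) (d _ (aut⇒iso a) (λ v → trans (cong c (φψ _)) (e _)) (ψ x))) (φψ x)))

-- Class representatives, ranks of colours, and the standard palette.

representatives : ∀ {X : Set} {R : X → X → Set} (R? : ∀ x y → Dec (R x y)) → (∀ {x} → R x x) → ∀ xs →
  ∃ λ ys → ys ⊆ xs × AllPairs (λ x y → ¬ R x y) ys × (∀ {x} → x ∈ xs → Any (R x) ys)
representatives R? R-refl [] = [] , (λ ()) , [] , λ ()
representatives R? R-refl (x ∷ xs) with representatives R? R-refl xs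
... | ys , sub , pw , cover with Any.any? (R? x) ys
...   | yes p = ys , there ∘ sub , pw , λ { (here refl) → p ; (there m) → cover m }
...   | no ¬p = x ∷ ys , (λ { (here e) → here e ; (there m) → there (sub m) }) , All.¬Any⇒All¬ ys ¬p ∷ pw ,
  λ { (here refl) → here R-refl ; (there m) → there (cover m) }

allPairs-lookup : ∀ {X : Set} {R : X → X → Set} → (∀ {x y} → R x y → R y x) → ∀ {xs} →
  AllPairs (λ x y → ¬ R x y) xs → ∀ i j → R (List.lookup xs i) (List.lookup xs j) → i ≡ j
allPairs-lookup R-sym (n ∷ ns) Fin.zero Fin.zero r = refl
allPairs-lookup R-sym (n ∷ ns) Fin.zero (Fin.suc j) r = ⊥-elim (All.lookup n (∈-lookup j) r)
allPairs-lookup R-sym (n ∷ ns) (Fin.suc i) Fin.zero r = ⊥-elim (All.lookup n (∈-lookup i) (R-sym r))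
allPairs-lookup R-sym (n ∷ ns) (Fin.suc i) (Fin.suc j) r = cong Fin.suc (allPairs-lookup R-sym ns i j r)

-- For a list without repetition this numbers the entries from 1 upwards in increasing order. Being
-- a count, it agrees on two such lists with the same entries in different orders.
rank : List ℕ → ℕ → ℕ
rank xs y = length (filter (ℕ._≤? y) xs)

rank-≥1 : ∀ {xs y} → y ∈ xs → 1 ≤ rank xs y
rank-≥1 {y = y} m = ∈-length (∈-filter⁺ (ℕ._≤? y) m ℕ.≤-refl)

rank-mono-⊆ : ∀ {xs ys} → Unique xs → xs ⊆ ys → ∀ y → rank xs y ≤ rank ys y
rank-mono-⊆ u sub y = unique-⊆⇒length-≤ (Unique.filter⁺ (ℕ._≤? y) u)
  (λ m → let (p , q) = ∈-filter⁻ (ℕ._≤? y) m in ∈-filter⁺ (ℕ._≤? y) (sub p) q)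

-- Everything counted at `x` is counted at `y`, and `y` itself is counted only at `y`.
rank-mono-< : ∀ {xs x y} → Unique xs → y ∈ xs → x < y → rank xs x < rank xs y
rank-mono-< {xs} {x} {y} u m x<y = unique-⊆⇒length-≤
  (All.tabulate (λ { p refl → ℕ.<⇒≱ x<y (proj₂ (∈-filter⁻ (ℕ._≤? x) {xs = xs} p)) }) ∷ Unique.filter⁺ (ℕ._≤? x) u)
  λ { (here refl) → ∈-filter⁺ (ℕ._≤? y) m ℕ.≤-refl
    ; (there p) → let (q , r) = ∈-filter⁻ (ℕ._≤? x) {xs = xs} p in ∈-filter⁺ (ℕ._≤? y) q (ℕ.≤-trans r (ℕ.<⇒≤ x<y)) }

rank-injective : ∀ {xs x y} → Unique xs → x ∈ xs → y ∈ xs → rank xs x ≡ rank xs y → x ≡ y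
rank-injective {xs} {x} {y} u p q e with ℕ.<-cmp x y
... | tri< x<y _ _ = ⊥-elim (ℕ.<-irrefl e (rank-mono-< u q x<y))
... | tri≈ _ x≡y _ = x≡y
... | tri> _ _ y<x = ⊥-elim (ℕ.<-irrefl (sym e) (rank-mono-< u p y<x))

-- Makes `k`-colourings the list colourings of a constant assignment, so both counts become
-- instances of `DLIs`.
palette : ℕ → List ℕ
palette k = map suc (upTo k)

∈-palette⁺ : ∀ {k c} → (1 ≤ c) × (c ≤ k) → c ∈ palette k
∈-palette⁺ {c = suc c} (_ , le) = ∈-map⁺ suc (∈-upTo⁺ le)

∈-palette⁻ : ∀ {k c} → c ∈ palette k → (1 ≤ c) × (c ≤ k)
∈-palette⁻ m with ∈-map⁻ suc m
... | _ , p , refl = s≤s z≤n , ∈-upTo⁻ p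

length-palette : ∀ k → length (palette k) ≡ k
length-palette k = trans (List.length-map suc (upTo k)) (List.length-upTo k)

-- From counting colourings to counting classes.

module Counting {n : ℕ} (T : RootedTree n) (E : Embedding T) (onto : ∀ x → Hit T E x) where

  open Embedding E using (φ)
  open Bridge T E onto

  classCount-resp : ∀ {P Q : Coloring T → Set} {m} → (∀ {c} → P c → Q c) → (∀ {c} → Q c → P c) →
    ClassCount T P m → ClassCount T Q m
  classCount-resp f g (rep , adm , inj , cover) =
    rep , (λ i → let (p , d) = adm i in f p , d) , inj , λ c → cover c ∘ g

  representatives⇒classCount : ∀ L fs → fs ⊆ distColorings t (L ∘ φ) →
    AllPairs (λ f g → ¬ CIso (t , look t f) (t , look t g)) fs →
    (∀ {f} → f ∈ distColorings t (L ∘ φ) → Any (λ g → CIso (t , look t f) (t , look t g)) fs) →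
    DLIs T L (length fs)
  representatives⇒classCount L fs sub distinct cover = rep , admissible , inequivalent , covering
    where
    rep : Fin (length fs) → Coloring T
    rep i = look t (List.lookup fs i) ∘ ψ

    rep-ciso : ∀ i → CIso (t , rep i ∘ φ) (t , look t (List.lookup fs i))
    rep-ciso i = ciso-≗ (λ v → cong (look t (List.lookup fs i)) (sym (ψφ v)))

    admissible : ∀ i → IsLColoring T L (rep i) × IsDistinguishing T (rep i)
    admissible i =
      let (m , d) = ∈-distColorings⁻ t (L ∘ φ) (sub (∈-lookup i))
      in (λ x → subst (λ y → rep i x ∈ L y) (φψ x) (m (ψ x)))
       , dist⇒distinguishing (dist-resp-ciso (rep-ciso i) d)

    inequivalent : ∀ i j → Equivalent T (rep i) (rep j) → i ≡ j
    inequivalent i j e = allPairs-lookup ciso-sym distinct i j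
      (ciso-trans (ciso-sym (rep-ciso i)) (ciso-trans (equivalent⇒ciso (rep i) (rep j) e) (rep-ciso j)))

    covering : ∀ c → IsLColoring T L c → IsDistinguishing T c → ∃ λ i → Equivalent T c (rep i)
    covering c m d = Any.index p , ciso⇒equivalent c (rep (Any.index p)) (ciso-trans f-ciso
        (ciso-trans (Any.lookup-index p) (ciso-sym (rep-ciso (Any.index p)))))
      where
      f-ciso : CIso (t , c ∘ φ) (t , look t (tab t (c ∘ φ)))
      f-ciso = ciso-≗ (look-tab t (c ∘ φ))

      p : Any (λ g → CIso (t , look t (tab t (c ∘ φ))) (t , look t g)) fs
      p = cover (∈-distColorings⁺ t (L ∘ φ)
        (λ v → subst (_∈ L (φ v)) (sym (look-tab t (c ∘ φ) v)) (m (φ v)))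
        (dist-resp-ciso (ciso-sym f-ciso) (distinguishing⇒dist d)))

  classCount-exists : ∀ L → ∃ (DLIs T L)
  classCount-exists L =
    let (fs , sub , distinct , cover) = representatives {R = λ f g → CIso (t , look t f) (t , look t g)}
          (λ f g → ciso? (t , look t f) (t , look t g)) (ciso-≗ (λ _ → refl)) (distColorings t (L ∘ φ))
    in length fs , representatives⇒classCount L fs sub distinct cover

  order : ℕ
  order = length (isos t t)

  order>0 : 0 < order
  order>0 = ∈-length (∈-isos⁺ {t} {t} iso-id)

  classes : ∀ {m} → (Fin m → Coloring T) → List ColoredTree
  classes rep = List.tabulate (λ i → t , rep i ∘ φ)

  isoTotal-classes : ∀ m (rep : Fin m → Coloring T) → isoTotal t (map proj₁ (classes rep)) ≡ m * order
  isoTotal-classes zero rep = refl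
  isoTotal-classes (suc m) rep = cong (order +_) (isoTotal-classes m (rep ∘ Fin.suc))

  covered : ∀ {L m} (D : DLIs T L m) {f} → f ∈ distColorings t (L ∘ φ) →
    Any (CIso (t , look t f)) (classes (proj₁ D))
  covered {L} (rep , _ , _ , cover) {f} f∈ =
    let (m , d) = ∈-distColorings⁻ t (L ∘ φ) f∈
        back = ciso-≗ (λ v → cong (look t f) (ψφ v))
        (i , e) = cover (look t f ∘ ψ) (λ x → subst (λ y → look t f (ψ x) ∈ L y) (φψ x) (m (ψ x)))
          (dist⇒distinguishing (dist-resp-ciso (ciso-sym back) d))
    in lose (∈-tabulate⁺ i) (ciso-trans back (equivalent⇒ciso (look t f ∘ ψ) (rep i) e))

  -- The constant list is invariant under automorphisms, so each class lies entirely among the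
  -- `K`-colourings; the action is free, so each class has `order` elements.
  classCount-≤ : ∀ {K b} → DLIs T (λ _ → K) b → b * order ≤ length (distColorings t (λ _ → K))
  classCount-≤ {K} {b} (rep , adm , inj , _) = subst (_≤ length (distColorings t (λ _ → K))) (isoTotal-classes b rep)
    (isoTotal-≤-length t (classes rep)
      (All.tabulate⁺ (λ i → distinguishing⇒dist (proj₂ (adm i))))
      (AllPairs.tabulate⁺ (λ {i} {j} i≢j e → i≢j (inj i j (ciso⇒equivalent (rep i) (rep j) e))))
      member)
    where
    member : ∀ {g} → Any (CIso (t , look t g)) (classes rep) → g ∈ distColorings t (λ _ → K)
    member a =
      let (i , c@(ciso τ _ e)) = Any.tabulate⁻ a
      in ∈-distColorings⁺ t (λ _ → K)
           (λ v → subst (_∈ K) (e v) (proj₁ (adm i) (φ (τ v))))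
           (dist-resp-ciso c (distinguishing⇒dist (proj₂ (adm i))))

  module _ (K : List ℕ) (L : Fin n → List ℕ) (l : IsListAssignment (length K) L) where

    classCount-mono : ∀ {a b} → DLIs T L a → DLIs T (λ _ → K) b → b ≤ a
    classCount-mono {a} {b} D D′ = ℕ.*-cancelʳ-≤ b a order ⦃ >-nonZero order>0 ⦄ (begin
      b * order ≤⟨ classCount-≤ D′ ⟩
      length (distColorings t (λ _ → K)) ≤⟨ distColorings-≤ t K (l ∘ φ) ⟩
      length (distColorings t (L ∘ φ)) ≤⟨ length-≤-isoTotal t (classes (proj₁ D)) (distColorings-unique t (proj₁ ∘ l ∘ φ)) (covered D) ⟩
      isoTotal t (map proj₁ (classes (proj₁ D))) ≡⟨ isoTotal-classes a (proj₁ D) ⟩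
      a * order ∎)
      where open ℕ.≤-Reasoning

    -- With equally many classes the lists leave no room: every colouring equivalent to a
    -- distinguishing L-colouring must be an L-colouring too.
    closed-under-aut : ∀ {a b} → DLIs T L a → DLIs T (λ _ → K) b → a ≡ b →
      ∀ {f τ} → f ∈ distColorings t (L ∘ φ) → IsIso τ → ∀ v → look t f (τ v) ∈ L (φ v)
    closed-under-aut {a} D D′ refl {f} {τ} f∈ i v =
      subst (_∈ L (φ v)) (look-tab t (look t f ∘ τ) v) (proj₁ (∈-distColorings⁻ t (L ∘ φ) h∈) v)
      where
      open ℕ.≤-Reasoning
      h : Tab ℕ t
      h = tab t (look t f ∘ τ)

      h-ciso : CIso (t , look t h) (t , look t f)
      h-ciso = ciso τ i (sym ∘ look-tab t (look t f ∘ τ))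

      h∈ : h ∈ distColorings t (L ∘ φ)
      -- If `h` were missing, adjoining it would give one more colouring covered by the `a` classes
      -- than `a * order` permits.
      h∈ = decidable-stable (Any.any? (tab-≟ t h) (distColorings t (L ∘ φ))) λ ¬p → ℕ.<-irrefl refl (begin-strict
        length (distColorings t (L ∘ φ)) <⟨ length-≤-isoTotal t (classes (proj₁ D))
          (All.¬Any⇒All¬ _ ¬p ∷ distColorings-unique t (proj₁ ∘ l ∘ φ))
          (λ { (here refl) → Any.map (ciso-trans h-ciso) (covered D f∈) ; (there m) → covered D m }) ⟩
        isoTotal t (map proj₁ (classes (proj₁ D))) ≡⟨ isoTotal-classes a (proj₁ D) ⟩
        a * order ≤⟨ classCount-≤ D′ ⟩
        length (distColorings t (λ _ → K)) ≤⟨ distColorings-≤ t K (l ∘ φ) ⟩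
        length (distColorings t (L ∘ φ)) ∎)

    -- A colour in the list at `τ w` is attained there by some distinguishing `L`-colouring `f`. By
    -- closure `f ∘ τ` respects the lists too, so the colour lies in the list at `w`. The
    -- automorphism and its inverse give the two inclusions.
    equal⇒orbit-constant : ∀ {a b} → DLIs T L a → DLIs T (λ _ → K) b → a ≡ b → 0 < b →
      ∀ u v → SameOrbit T u v → ∀ c → (c ∈ L u ⇔ c ∈ L v)
    equal⇒orbit-constant {b = b} D D′ a≡b b>0 u v (σ , aut , σu≡v) c = mk⇔
      (λ m → subst (λ x → c ∈ L x) (φψ v)
        (pull-back (iso-inverse i) (subst (λ x → c ∈ L x) (trans (sym (φψ u)) (cong φ (sym ψv↦ψu))) m)))
      (λ m → subst (λ x → c ∈ L x) (φψ u)
        (pull-back i (subst (λ x → c ∈ L x) (trans (sym (φψ v)) (cong φ (sym ψu↦ψv))) m)))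
      where
      i : IsIso (ψ ∘ σ ∘ φ)
      i = aut⇒iso aut

      ψu↦ψv : ψ (σ (φ (ψ u))) ≡ ψ v
      ψu↦ψv = cong ψ (trans (cong σ (φψ u)) σu≡v)

      ψv↦ψu : inverse i (ψ v) ≡ ψ u
      ψv↦ψu = trans (cong (inverse i) (sym ψu↦ψv)) (inverseˡ i (ψ u))

      inhabited : ∃ (_∈ distColorings t (λ _ → K))
      inhabited = nonempty (ℕ.≤-trans (ℕ.*-mono-≤ b>0 order>0) (classCount-≤ D′))

      pull-back : ∀ {τ w} → IsIso τ → c ∈ L (φ (τ w)) → c ∈ L (φ w)
      pull-back {τ} {w} j m =
        let (f , f∈ , e) = color-attained t K (l ∘ φ) inhabited (τ w) m
        in subst (_∈ L (φ w)) e (closed-under-aut D D′ a≡b f∈ j w)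

    module _ (constant : ∀ u v → SameOrbit T u v → ∀ c → (c ∈ L u ⇔ c ∈ L v)) where

      recolor : Coloring T → Coloring T
      recolor c x = rank (L x) (c x)

      -- The lists at `x` and `σ x` have the same entries, hence the same ranks, and rank is
      -- injective on entries.
      recolor-reflects : ∀ {c d σ} → IsLColoring T L c → IsLColoring T L d → IsAut T σ →
        (∀ x → recolor c x ≡ recolor d (σ x)) → ∀ x → c x ≡ d (σ x)
      recolor-reflects {c} {d} {σ} mc md aut e x = rank-injective (proj₁ (l x)) (mc x) (from (md (σ x)))
        (trans (e x) (ℕ.≤-antisym (rank-mono-⊆ (proj₁ (l (σ x))) from _) (rank-mono-⊆ (proj₁ (l x)) to _)))
        where
        to : L x ⊆ L (σ x)
        to = Equivalence.to (constant x (σ x) (σ , aut , refl) _)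
        from : L (σ x) ⊆ L x
        from = Equivalence.from (constant x (σ x) (σ , aut , refl) _)

      -- Recolouring by rank yields `k`-colourings and reflects colour preservation, so
      -- distinguishing colourings stay distinguishing and inequivalent ones stay inequivalent.
      orbit-constant⇒≤ : ∀ {a b} → DLIs T L a → DLIs T (λ _ → palette (length K)) b → a ≤ b
      orbit-constant⇒≤ {a} {b} (rep , adm , inj , _) (rep′ , _ , _ , cover) = Fin.injective⇒≤ {f = target} target-injective
        where
        image : ∀ i → ∃ λ j → Equivalent T (recolor (rep i)) (rep′ j)
        image i = cover (recolor (rep i))
          (λ x → ∈-palette⁺ (rank-≥1 (proj₁ (adm i) x) , subst (rank (L x) (rep i x) ≤_) (proj₂ (l x)) (List.length-filter (ℕ._≤? rep i x) (L x))))
          (λ σ aut e → proj₂ (adm i) σ aut λ x →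
            sym (recolor-reflects (proj₁ (adm i)) (proj₁ (adm i)) aut (sym ∘ e) x))

        target : Fin a → Fin b
        target = proj₁ ∘ image

        target-injective : ∀ {i j} → target i ≡ target j → i ≡ j
        target-injective {i} {j} p = inj i j (reflect (ciso⇒equivalent (recolor (rep i)) (recolor (rep j))
          (ciso-trans (to-rep′ i) (ciso-sym (subst (λ q → CIso _ (t , rep′ q ∘ φ)) (sym p) (to-rep′ j))))))
          where
          to-rep′ : ∀ i → CIso (t , recolor (rep i) ∘ φ) (t , rep′ (target i) ∘ φ)
          to-rep′ i = equivalent⇒ciso (recolor (rep i)) (rep′ (target i)) (proj₂ (image i))

          reflect : Equivalent T (recolor (rep i)) (recolor (rep j)) → Equivalent T (rep i) (rep j)
          reflect (σ , aut , e) = σ , aut , recolor-reflects (proj₁ (adm i)) (proj₁ (adm j)) aut e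

theorem5 : ∀ {n : ℕ} (T : RootedTree n) (k : ℕ) → 1 ≤ k →
    (L : Fin n → List ℕ) → IsListAssignment k L →
    (∃ λ a → DLIs T L a) × (∃ λ b → DkIs T k b) ×
    (∀ a b → DLIs T L a → DkIs T k b →
    (b ≤ a) ×
    ((a ≡ b) ⇔ ((a ≡ 0) ⊎ (∀ u v → SameOrbit T u v → ∀ c → (c ∈ L u ⇔ c ∈ L v)))))
theorem5 T k _ L l =
  classCount-exists L ,
  (let (b , D) = classCount-exists (λ _ → palette k) in b , classCount-resp (λ m v → ∈-palette⁻ (m v)) (λ m v → ∈-palette⁺ (m v)) D) ,
  compare
  where
  open Counting T (proj₁ (model T)) (proj₂ (model T))

  l′ : IsListAssignment (length (palette k)) L
  l′ = subst (λ m → IsListAssignment m L) (sym (length-palette k)) l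

  compare : ∀ a b → DLIs T L a → DkIs T k b →
    (b ≤ a) × ((a ≡ b) ⇔ ((a ≡ 0) ⊎ (∀ u v → SameOrbit T u v → ∀ c → (c ∈ L u ⇔ c ∈ L v))))
  compare a b D Dk = b≤a , mk⇔ forth back
    where
    D′ : DLIs T (λ _ → palette k) b
    D′ = classCount-resp (λ m v → ∈-palette⁺ (m v)) (λ m v → ∈-palette⁻ (m v)) Dk

    b≤a : b ≤ a
    b≤a = classCount-mono (palette k) L l′ D D′

    Constant = ∀ u v → SameOrbit T u v → ∀ c → (c ∈ L u ⇔ c ∈ L v)

    forth : a ≡ b → (a ≡ 0) ⊎ Constant
    forth a≡b with a ℕ.≟ 0
    ... | yes a≡0 = inj₁ a≡0
    ... | no a≢0 = inj₂ (equal⇒orbit-constant (palette k) L l′ D D′ a≡b (subst (0 <_) a≡b (ℕ.n≢0⇒n>0 a≢0)))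

    back : (a ≡ 0) ⊎ Constant → a ≡ b
    back (inj₁ refl) = sym (ℕ.n≤0⇒n≡0 b≤a)
    back (inj₂ constant) = ℕ.≤-antisym
      (orbit-constant⇒≤ (palette k) L l′ constant D (subst (λ m → DLIs T (λ _ → palette m) b) (sym (length-palette k)) D′)) b≤a
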